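{- Let $G=\langle V,E\rangle$ be a weighted directed graph with $n$ vertices and real (possibly negative) arc weights, let $d:V\to\{1,\dots,n\}$ be a vertex ordering, let $w_d$ be the width of $G$ induced by $d$, and let $m_c$ be the number of edges of the chordal graph obtained by triangulating $G$ along $d$. Then the algorithm Snowball, run on input $(G,d)$, correctly computes all-pairs shortest paths in $\mathcal{O}(n\,m_c)\subseteq\mathcal{O}(n^2 w_d)$ time.
   Context: Graphs are finite, without self-loops, with at most one arc $i\to j$ for each ordered pair. A vertex ordering is a bijection $d:V\to\{1,\dots,n\}$; vertices are identified with their positions, so $V=\{1,\dots,n\}$. $w_{i\to j}\in\mathbb{R}$ is the weight of the arc $i\to j$ (read as $+\infty$ if that arc is absent). We write $\{i,j\}\in E$ if there is an arc between $i$ and $j$ in either direction; "edges" and "neighbours" refer to this underlying undirected graph. A negative cycle is a closed path with negative total weight. The specified output of Snowball is the matrix $D$ of shortest-path distances ($D[i][j]$ being the length of a shortest directed path from $i$ to $j$ in $G$), or INCONSISTENT if $G$ contains a negative cycle. Induced width: for $1\le k\le n$ let $E'_k=\{\{j,k\}\subseteq V : j<k$ and there is a path from $k$ to $j$ in the underlying undirected graph of $G$ induced on $\{j\}\cup\{k,k+1,\dots,n\}\}$. Then $w_d=\max_{k\in V}|E'_k|$. Triangulating along $d$ means: for $k=n,n-1,\dots,1$, add an edge between every pair of neighbours $i<j<k$ of $k$. The resulting graph is chordal (every cycle of length greater than 3 has a chord), and $m_c$ is its number of edges. Algorithm DPC (input $G$, $d$): For $k=n$ down to $1$, for all $i<j<k$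 with $\{i,k\},\{j,k\}\in E$: set $w_{i\to j}\leftarrow\min\{w_{i\to j},w_{i\to k}+w_{k\to j}\}$, $w_{j\to i}\leftarrow\min\{w_{j\to i},w_{j\to k}+w_{k\to i}\}$, $E\leftarrow E\cup\{\{i,j\}\}$; if $w_{i\to j}+w_{j\to i}<0$, return INCONSISTENT. Return the modified graph $G$. Algorithm Snowball (input $G$, $d$): Replace $G$ by DPC$(G,d)$; return INCONSISTENT if DPC did. Set $D[i][j]\leftarrow\infty$ for all $i,j\in V$, then $D[i][i]\leftarrow 0$ for all $i\in V$. For $k=1$ to $n$: for all $j<k$ with $\{j,k\}\in E$ (the edge set after DPC): for all $i\in\{1,\dots,k-1\}$: $D[i][k]\leftarrow\min\{D[i][k],D[i][j]+w_{j\to k}\}$ and $D[k][i]\leftarrow\min\{D[k][i],w_{k\to j}+D[j][i]\}$. Return $D$.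
   Formalization: INCONSISTENT is guaranteed on a negative cycle only if no two opposite arcs have negative sum (DPC may not test such a pair); O(n m_c) time is for graphs without isolated vertices, with O(n^2 + n m_c) in general, since initialising D takes n^2 steps even if m_c = 0. -}

module Defs where

open import Level using (Level; _⊔_; 0ℓ) renaming (suc to lsuc)
open import Algebra.Core using (Op₁; Op₂)
open import Algebra.Structures using (IsAbelianGroup)
open import Data.Bool.Base using (Bool; true; false; _∧_; _∨_; not; T; if_then_else_)
open import Data.Bool.Properties using (T?)
open import Data.Fin.Base using (Fin; zero; suc; _<_; _≤_)
open import Data.Fin.Properties using (_<?_; _≤?_; _≟_; any?)
open import Data.List.Base
  using (List; []; _∷_; allFin; filter; foldr; length; map; reverse)
open import Data.List.Extrema.Nat using (max)
open import Data.Maybe.Base using (Maybe; just; nothing; is-just)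
open import Data.Nat.Base as ℕ using (ℕ)
open import Data.Nat.ListAction using (sum)
open import Data.Product.Base using (Σ; ∃; _×_; _,_; -,_)
open import Data.Sum.Base using (_⊎_; inj₁; inj₂)
open import Data.Vec.Functional using (updateAt)
open import Function.Base using (_∘_; const)
open import Function.Bundles using (_↔_; Inverse)
open import Relation.Binary.Core using (Rel; _=[_]⇒_)
open import Relation.Binary.Definitions using (Decidable)
open import Relation.Binary.Structures using (IsDecTotalOrder)
open import Relation.Binary.Construct.Closure.ReflexiveTransitive
  using (Star; ε; _◅_; _◅◅_; kleisliStar)
import Relation.Binary.Construct.NonStrictToStrict as NonStrictToStrict
open import Relation.Binary.PropositionalEquality.Core using (_≡_)
open import Relation.Nullary.Construct.Add.Supremum using (_⁺; ⊤⁺; [_])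
open import Relation.Nullary.Decidable
  using (Dec; yes; no; ⌊_⌋; map′; _×-dec_; _⊎-dec_)
open import Relation.Nullary.Negation.Core using (¬_)
open import Relation.Unary using (Pred)

------------------------------------------------------------------------
-- Weights

-- The real line enters only through its addition and its linear order; the
-- comparison of two weights is a machine operation, hence decidable.

record DecTotallyOrderedAbelianGroup c ℓ₁ ℓ₂ : Set (lsuc (c ⊔ ℓ₁ ⊔ ℓ₂)) where
  infix  4 _≈_ _≤ʷ_
  infixl 6 _+_
  field
    Carrier         : Set c
    _≈_             : Rel Carrier ℓ₁
    _≤ʷ_            : Rel Carrier ℓ₂
    _+_             : Op₂ Carrier
    0#              : Carrier
    -_              : Op₁ Carrier
    isAbelianGroup  : IsAbelianGroup _≈_ _+_ 0# -_
    isDecTotalOrder : IsDecTotalOrder _≈_ _≤ʷ_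
    +-monoʳ-≤       : ∀ x {y z} → y ≤ʷ z → (x + y) ≤ʷ (x + z)

  open IsDecTotalOrder isDecTotalOrder public
    using () renaming (_≟_ to _≟ʷ_; _≤?_ to _≤ʷ?_)
  open NonStrictToStrict _≈_ _≤ʷ_ public
    using () renaming (_<_ to _<ʷ_)

  _<ʷ?_ : Decidable _<ʷ_
  _<ʷ?_ = NonStrictToStrict.<-decidable _≈_ _≤ʷ_ _≟ʷ_ _≤ʷ?_

------------------------------------------------------------------------
-- Reachability in a finite decidable relation is decidable (by eliminating
-- the vertices one after the other).

module _ {ℓ : Level} where

  Eliminate₀ : ∀ {n} → Rel (Fin (ℕ.suc n)) ℓ → Rel (Fin n) ℓ
  Eliminate₀ R i j =
    R (suc i) (suc j) ⊎ (R (suc i) zero × R zero (suc j))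

  module _ {n : ℕ} (R : Rel (Fin (ℕ.suc n)) ℓ) where

    private
      expand : Eliminate₀ R =[ suc ]⇒ Star R
      expand (inj₁ r)       = r ◅ ε
      expand (inj₂ (r , s)) = r ◅ s ◅ ε

      up : Star (Eliminate₀ R) =[ suc ]⇒ Star R
      up = kleisliStar suc expand

      down  : ∀ {i j} → Star R (suc i) (suc j) → Star (Eliminate₀ R) i j
      down₀ : ∀ {i j} → R (suc i) zero → Star R zero (suc j) →
              Star (Eliminate₀ R) i j
      down ε                        = ε
      down (_◅_ {j = zero}  r p)    = down₀ r p
      down (_◅_ {j = suc _} r p)    = inj₁ r ◅ down p
      down₀ r (_◅_ {j = zero}  _ p) = down₀ r p
      down₀ r (_◅_ {j = suc _} s p) = inj₂ (r , s) ◅ down p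

      leave : ∀ {j} → Star R zero (suc j) →
              ∃ λ k → R zero (suc k) × Star (Eliminate₀ R) k j
      leave (_◅_ {j = zero}  _ p) = leave p
      leave (_◅_ {j = suc k} r p) = k , r , down p

      enter : ∀ {i} → Star R (suc i) zero →
              ∃ λ k → R (suc k) zero × Star (Eliminate₀ R) i k
      enter (_◅_ {j = zero}  r _) = -, r , ε
      enter (_◅_ {j = suc _} r p) =
        let (k , s , q) = enter p in k , s , inj₁ r ◅ q

    restore? : Decidable R → Decidable (Star (Eliminate₀ R)) →
               Decidable (Star R)
    restore? R? S? zero    zero    = yes ε
    restore? R? S? (suc i) (suc j) = map′ up down (S? i j)
    restore? R? S? zero    (suc j) =
      map′ (λ (_ , r , p) → r ◅ up p) leave
        (any? λ k → R? zero (suc k) ×-dec S? k j)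
    restore? R? S? (suc i) zero    =
      map′ (λ (_ , r , p) → up p ◅◅ (r ◅ ε)) enter
        (any? λ k → R? (suc k) zero ×-dec S? i k)

  star? : ∀ {n} {R : Rel (Fin n) ℓ} → Decidable R → Decidable (Star R)
  star? {ℕ.suc n} {R} R? = restore? R R? (star? λ i j →
    R? (suc i) (suc j) ⊎-dec (R? (suc i) zero ×-dec R? zero (suc j)))

------------------------------------------------------------------------
-- Undirected graphs on positions

Matrix : ∀ {a} → Set a → ℕ → Set a
Matrix A n = Fin n → Fin n → A

module _ {n : ℕ} where

  below : Fin n → List (Fin n)
  below k = filter (_<? k) (allFin n)

  -- Each edge {j,k} with j < k is counted once, at k.
  edgeCount : Matrix Bool n → ℕ
  edgeCount E =
    sum (map (λ k → length (filter (λ j → T? (E j k)) (below k))) (allFin n))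

  connectNeighbours : Fin n → Matrix Bool n → Matrix Bool n
  connectNeighbours k E i j =
    E i j ∨ (not ⌊ i ≟ j ⌋ ∧ ⌊ i <? k ⌋ ∧ ⌊ j <? k ⌋ ∧ E i k ∧ E j k)

  -- foldr treats the last vertex first.
  triangulate : Matrix Bool n → Matrix Bool n
  triangulate E = foldr connectNeighbours E (allFin n)

  InducedOn : Fin n → Fin n → Pred (Fin n) 0ℓ
  InducedOn j k v = v ≡ j ⊎ k ≤ v

  InducedEdge : Matrix Bool n → Fin n → Fin n → Rel (Fin n) 0ℓ
  InducedEdge E j k u v = InducedOn j k u × InducedOn j k v × T (E u v)

  -- {j,k} ∈ E′ₖ
  E′ : Matrix Bool n → Fin n → Pred (Fin n) 0ℓ
  E′ E k j = j < k × Star (InducedEdge E j k) k j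

  E′? : ∀ E k j → Dec (E′ E k j)
  E′? E k j = (j <? k) ×-dec star? edge? k j
    where
    on? : ∀ v → Dec (InducedOn j k v)
    on? v = (v ≟ j) ⊎-dec (k ≤? v)

    edge? : Decidable (InducedEdge E j k)
    edge? u v = on? u ×-dec on? v ×-dec T? (E u v)

  inducedWidth : Matrix Bool n → ℕ
  inducedWidth E =
    max 0 (map (λ k → length (filter (E′? E k) (allFin n))) (allFin n))

------------------------------------------------------------------------
-- Unit-cost computations which may stop early

-- The number of elementary steps performed, and the value returned, or
-- `nothing` if the computation was stopped.
Comp : ∀ {a} → Set a → Set a
Comp A = ℕ × Maybe A

pattern INCONSISTENT = nothing

module _ {a} {A : Set a} where

  infixl 1 _>>=_ _>>_

  return : A → Comp A
  return x = 0 , just x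

  _>>=_ : ∀ {b} {B : Set b} → Comp A → (A → Comp B) → Comp B
  (s , nothing) >>= f = s , nothing
  (s , just x)  >>= f = let (t , r) = f x in s ℕ.+ t , r

  _>>_ : ∀ {b} {B : Set b} → Comp A → Comp B → Comp B
  m >> m′ = m >>= const m′

  -- An elementary operation.
  step : A → Comp A
  step x = 1 , just x

  stop : Comp A
  stop = 1 , INCONSISTENT

-- Run the body once per element, threading the memory contents; each
-- iteration is itself charged one step.
for : ∀ {a b} {A : Set a} {B : Set b} →
      List A → B → (A → B → Comp B) → Comp B
for []       s body = return s
for (x ∷ xs) s body = do
  x  ← step x
  s′ ← body x s
  for xs s′ body

module _ {a} {A : Set a} {n : ℕ} where

  allocate : A → Comp (Matrix A n)
  allocate x = n ℕ.* n , just λ _ _ → x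

  read : Matrix A n → Fin n → Fin n → Comp A
  read M i j = step (M i j)

  write : Fin n → Fin n → A → Matrix A n → Comp (Matrix A n)
  write i j x M = step (updateAt M i λ row → updateAt row j (const x))

-- The j < k with {j,k} ∈ E, found by scanning a column of the adjacency
-- matrix.
lowerNeighbours : ∀ {n} → Matrix Bool n → Fin n → Comp (List (Fin n))
lowerNeighbours E k = for (below k) [] λ j ns → do
  e ← read E j k
  if e then step (j ∷ ns) else return ns

------------------------------------------------------------------------
-- Asymptotic bounds: g is bounded by a constant multiple of f on all
-- inputs in P.

O[_] : ∀ {a ℓ} {A : Set a} → Pred A ℓ → (A → ℕ) → Pred (A → ℕ) (a ⊔ ℓ)
O[ P ] f g = ∃ λ C → ∀ x → P x → g x ℕ.≤ C ℕ.* f x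

------------------------------------------------------------------------

module Weighted {c ℓ₁ ℓ₂} (W : DecTotallyOrderedAbelianGroup c ℓ₁ ℓ₂) where

  open DecTotallyOrderedAbelianGroup W

  -- Weights extended with +∞, written ⊤⁺.

  infixl 6 _+⁺_

  _+⁺_ : Op₂ (Carrier ⁺)
  [ x ] +⁺ [ y ] = [ x + y ]
  [ _ ] +⁺ ⊤⁺    = ⊤⁺
  ⊤⁺    +⁺ _     = ⊤⁺

  min⁺ : Op₂ (Carrier ⁺)
  min⁺ ⊤⁺    y     = y
  min⁺ [ x ] ⊤⁺    = [ x ]
  min⁺ [ x ] [ y ] = if ⌊ x ≤ʷ? y ⌋ then [ x ] else [ y ]

  negative⁺ : Carrier ⁺ → Bool
  negative⁺ [ x ] = ⌊ x <ʷ? 0# ⌋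
  negative⁺ ⊤⁺    = false

  ----------------------------------------------------------------------
  -- Weighted directed graphs

  record Graph (V : Set) : Set c where
    field
      arc     : V → V → Carrier ⁺
      no-loop : ∀ v → arc v v ≡ ⊤⁺

    edge : V → V → Bool
    edge u v = is-just (arc u v) ∨ is-just (arc v u)

    Arc : Rel V c
    Arc u v = ∃ λ x → arc u v ≡ [ x ]

    Path : Rel V c
    Path = Star Arc

    weight : ∀ {u v} → Path u v → Carrier
    weight ε             = 0#
    weight ((x , _) ◅ p) = x + weight p

    NegativeCycle : Set (c ⊔ ℓ₁ ⊔ ℓ₂)
    NegativeCycle = ∃ λ v → Σ (Path v v) λ p → weight p <ʷ 0#

    NegativeTwoCycle : Set (c ⊔ ℓ₁ ⊔ ℓ₂)
    NegativeTwoCycle =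
      ∃ λ u → ∃ λ v → Σ (Arc u v) λ (x , _) → Σ (Arc v u) λ (y , _) →
        (x + y) <ʷ 0#

    data IsDistance (u v : V) : Carrier ⁺ → Set (c ⊔ ℓ₁ ⊔ ℓ₂) where
      unreachable : ¬ Path u v → IsDistance u v ⊤⁺
      shortest    : ∀ {x} (p : Path u v) → weight p ≈ x →
                    (∀ (q : Path u v) → x ≤ʷ weight q) → IsDistance u v [ x ]

    HasNoIsolatedVertex : Set
    HasNoIsolatedVertex = ∀ v → ∃ λ u → T (edge u v)

  open Graph

  relabel : ∀ {V n} → V ↔ Fin n → Graph V → Graph (Fin n)
  relabel d G = record
    { arc     = λ i j → arc G (from i) (from j)
    ; no-loop = λ i → no-loop G (from i)
    }
    where open Inverse d

  ----------------------------------------------------------------------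
  -- Algorithms

  -- M[i][j] ← min{M[i][j], x + y}
  relax : ∀ {n} → Fin n → Fin n → Carrier ⁺ → Carrier ⁺ →
          Matrix (Carrier ⁺) n → Comp (Matrix (Carrier ⁺) n)
  relax i j x y M = do
    z ← step (x +⁺ y)
    m ← read M i j
    m ← step (min⁺ m z)
    write i j m M

  -- The adjacency is stored separately from the weights, as DPC can add an
  -- edge {i,j} both of whose weights are +∞.
  Network : ℕ → Set c
  Network n = Matrix Bool n × Matrix (Carrier ⁺) n

  network : ∀ {n} → Graph (Fin n) → Network n
  network G = edge G , arc G

  module _ {n : ℕ} where

    connect : Fin n → Fin n → Fin n → Network n → Comp (Network n)
    connect k i j (E , w) = do
      w-ik ← read w i k
      w-kj ← read w k j
      w    ← relax i j w-ik w-kj w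
      w-jk ← read w j k
      w-ki ← read w k i
      w    ← relax j i w-jk w-ki w
      E    ← write i j true E
      E    ← write j i true E
      w-ij ← read w i j
      w-ji ← read w j i
      s    ← step (w-ij +⁺ w-ji)
      neg  ← step (negative⁺ s)
      if neg then stop else return (E , w)

    dpc : Network n → Comp (Network n)
    dpc N = for (reverse (allFin n)) N λ k (E , w) → do
      ns ← lowerNeighbours E k
      for ns (E , w) λ j N →
        for ns N λ i N → do
          i<j ← step ⌊ i <? j ⌋
          if i<j then connect k i j N else return N

    snowball : Network n → Comp (Matrix (Carrier ⁺) n)
    snowball N = do
      (E , w) ← dpc N
      D ← allocate ⊤⁺
      D ← for (allFin n) D λ i → write i i [ 0# ]
      for (allFin n) D λ k D → do
        ns ← lowerNeighbours E k
        for ns D λ j D →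
          for (below k) D λ i D → do
            D-ij ← read D i j
            w-jk ← read w j k
            D    ← relax i k D-ij w-jk D
            w-kj ← read w k j
            D-ji ← read D j i
            relax k i w-kj D-ji D

  ----------------------------------------------------------------------
  -- Inputs

  record Input : Set (lsuc 0ℓ ⊔ c) where
    field
      {Vertex} : Set
      n        : ℕ
      G        : Graph Vertex
      d        : Vertex ↔ Fin n

    open Inverse d public using () renaming (to to position)

    positioned : Graph (Fin n)
    positioned = relabel d G

    m-c : ℕ
    m-c = edgeCount (triangulate (edge positioned))

    w-d : ℕ
    w-d = inducedWidth (edge positioned)

    run : Comp (Matrix (Carrier ⁺) n)
    run = snowball (network positioned)

    time : ℕ
    time = let (t , _) = run in t

    output : Maybe (Matrix (Carrier ⁺) n)
    output = let (_ , r) = run in r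

{-# OPTIONS --safe #-}
-- DPC leaves weights w which are realised by paths of G and, on the filled
-- edges, satisfy w(i→j) ≤ w(i→k) + w(k→j) for i, j < k; moreover the checks
-- ensure w(i→j) + w(j→i) ≥ 0, if the input has no negative 2-cycle. These two
-- facts alone make D satisfy the triangle inequality
-- on the first m vertices for every m: D[i][k] and D[k][j] are attained
-- through lower neighbours a, b of k, and w(a→k) + w(k→b) ≥ D[a][b]. Hence D
-- is finally bounded by the weight of every path. Since D[v][v] = 0
-- is never overwritten, there is no negative cycle unless DPC reports one;
-- and as D is realised by paths, it is the distance matrix.
--
-- For the running time, each lower neighbourhood scanned by DPC or Snowball
-- lies inside that of the triangulated graph, and a filled edge {j,k} comes
-- from a path between j and k all of whose inner vertices exceed j and k.
module Submission where

open import Defs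
open import Level using (Level; _⊔_; 0ℓ)
open import Data.Maybe.Base using (Maybe; just; nothing; is-just)
open import Data.Nat.Base using (ℕ; zero; suc; _+_; _*_; _≤_; _<_; z≤n; s≤s)
open import Data.Product.Base using (Σ; ∃; _×_; _,_; proj₁; proj₂)
open import Relation.Binary.PropositionalEquality.Core
  using (_≡_; _≢_; refl; sym; trans; cong; cong₂; subst)
open import Relation.Nullary.Negation.Core using (¬_; contradiction)
open import Relation.Unary using (Pred; U; _∈_; _⊆_; Decidable)
open import Algebra.Structures using (IsAbelianGroup)
open import Data.Bool.Base using (Bool; true; false; T; if_then_else_)
open import Data.Bool.Properties using (T?; T-∧; T-∨)
open import Data.Fin.Base as Fin using (Fin; toℕ)
open import Data.Fin.Properties
  using (_<?_; _≟_; <-irrefl; <-asym; <-cmp; injective⇒≤; toℕ-injective; toℕ<n)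
open import Data.List.Base
  using (List; []; _∷_; _++_; _ʳ++_; allFin; concatMap; filter; foldr; length; lookup; map;
         reverse; tabulate)
open import Data.List.Extrema.Nat using (xs≤max)
open import Data.List.Membership.Propositional using () renaming (_∈_ to _∈ˡ_)
open import Data.List.Membership.Propositional.Properties
  using (∈-allFin; ∈-concatMap⁺; ∈-filter⁺; ∈-filter⁻; ∈-map⁺; ∈-++⁺ˡ; ∈-++⁺ʳ)
open import Data.List.Properties
  using (length-++; length-map; length-tabulate; length-filter; length-reverse; unfold-reverse)
open import Data.List.Relation.Binary.Sublist.Propositional using (⊆-refl)
open import Data.List.Relation.Binary.Sublist.Propositional.Properties
  using (length-mono-≤; filter⁺)
open import Data.List.Relation.Unary.All as All using ()
open import Data.List.Relation.Unary.AllPairs using (AllPairs; _∷_)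
open import Data.List.Relation.Unary.AllPairs.Properties using (tabulate⁺-<)
open import Data.List.Relation.Unary.Any as Any using (here; there; index)
open import Data.List.Relation.Unary.Any.Properties using (lookup-index; reverse⁺; reverse⁻)
open import Data.Nat.ListAction using (sum)
import Data.Nat.Properties as ℕₚ
open import Data.Nat.Solver using (module +-*-Solver)
open import Data.Sum.Base as Sum using (_⊎_; inj₁; inj₂)
open import Data.Vec.Functional using (updateAt)
open import Data.Vec.Functional.Properties using (updateAt-updates; updateAt-minimal)
open import Function.Base using (_∘_; const; id)
open import Function.Bundles using (_↔_; Equivalence; Inverse)
open import Relation.Binary.Bundles using (Poset)
import Relation.Binary.Construct.Add.Supremum.Equality as AddSupremumEquality
import Relation.Binary.Construct.Add.Supremum.NonStrict as AddSupremum
open import Relation.Binary.Construct.Closure.ReflexiveTransitive as Star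
  using (Star; ε; _◅_; _◅◅_)
import Relation.Binary.Construct.NonStrictToStrict as NonStrictToStrict
open import Relation.Binary.Definitions using (tri<; tri≈; tri>)
import Relation.Binary.Reasoning.PartialOrder as PosetReasoning
open import Relation.Binary.Structures using (IsDecTotalOrder)
open import Relation.Nullary.Construct.Add.Supremum using (_⁺; ⊤⁺; [_])
open import Relation.Nullary.Decidable using (yes; no; ⌊_⌋; does; _×-dec_)

-- Sums and lengths

module _ {a} {A : Set a} where

  sum-map-≤ : ∀ {f : A → ℕ} {b} xs → (∀ {x} → x ∈ˡ xs → f x ≤ b) →
              sum (map f xs) ≤ length xs * b
  sum-map-≤ []       f≤b = z≤n
  sum-map-≤ (x ∷ xs) f≤b =
    ℕₚ.+-mono-≤ (f≤b (here refl)) (sum-map-≤ xs (f≤b ∘ there))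

  length-concatMap : ∀ {b} {B : Set b} (f : A → List B) xs →
                     length (concatMap f xs) ≡ sum (map (length ∘ f) xs)
  length-concatMap f []       = refl
  length-concatMap f (x ∷ xs) =
    trans (length-++ (f x)) (cong (length (f x) +_) (length-concatMap f xs))

  length-filter-mono : ∀ {p q} {P : Pred A p} {Q : Pred A q}
                       (P? : Decidable P) (Q? : Decidable Q) → P ⊆ Q →
                       ∀ xs → length (filter P? xs) ≤ length (filter Q? xs)
  length-filter-mono P? Q? P⊆Q xs =
    length-mono-≤ (filter⁺ P? Q? (λ { refl → P⊆Q }) (⊆-refl {x = xs}))

-- Looking up the position of a member gives the member back, so the map from vertices to positions
-- is injective.
∀∈⇒≤length : ∀ {n} (xs : List (Fin n)) → (∀ i → i ∈ˡ xs) → n ≤ length xs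
∀∈⇒≤length xs ∈xs = injective⇒≤ {f = λ i → index (∈xs i)} λ {i} {j} eq →
  trans (lookup-index (∈xs i))
        (trans (cong (lookup xs) eq) (sym (lookup-index (∈xs j))))

-- Triangulation

module _ {n : ℕ} where

  Symmetricᵇ : Matrix Bool n → Set
  Symmetricᵇ E = ∀ {i j} → T (E i j) → T (E j i)

  lower : Matrix Bool n → Fin n → List (Fin n)
  lower E k = filter (λ j → T? (E j k)) (below k)

  degree : Matrix Bool n → Fin n → ℕ
  degree E k = length (lower E k)

  ∈-below : ∀ {j k : Fin n} → j Fin.< k → j ∈ˡ below k
  ∈-below {j} {k} j<k = ∈-filter⁺ (_<? k) (∈-allFin j) j<k

  ∈-lower : ∀ E {j k : Fin n} → j Fin.< k → T (E j k) → j ∈ˡ lower E k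
  ∈-lower E {k = k} j<k e = ∈-filter⁺ (λ j → T? (E j k)) (∈-below j<k) e

  ∈-below⁻ : ∀ {j k : Fin n} → j ∈ˡ below k → j Fin.< k
  ∈-below⁻ {k = k} j∈ = proj₂ (∈-filter⁻ (_<? k) {xs = allFin n} j∈)

  ∈-lower⁻ : ∀ E {j k : Fin n} → j ∈ˡ lower E k → j Fin.< k × T (E j k)
  ∈-lower⁻ E {k = k} j∈ =
    let (j∈below , e) = ∈-filter⁻ (λ j → T? (E j k)) {xs = below k} j∈ in ∈-below⁻ j∈below , e

  length-below : ∀ (k : Fin n) → length (below k) ≤ n
  length-below k = ℕₚ.≤-trans (length-filter (_<? k) (allFin n))
                              (ℕₚ.≤-reflexive (length-tabulate {n = n} id))

  length-lower : ∀ E (k : Fin n) → length (lower E k) ≤ n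
  length-lower E k =
    ℕₚ.≤-trans (length-filter (λ j → T? (E j k)) (below k)) (length-below k)

  module _ (k : Fin n) (E : Matrix Bool n) {i j : Fin n} where

    connect-⊇ : T (E i j) → T (connectNeighbours k E i j)
    connect-⊇ e = Equivalence.from T-∨ (inj₁ e)

    connect⁺ : i ≢ j → i Fin.< k → j Fin.< k → T (E i k) → T (E j k) →
               T (connectNeighbours k E i j)
    connect⁺ i≢j i<k j<k eik ejk with i ≟ j | i <? k | j <? k
    ... | yes i≡j | _       | _       = contradiction i≡j i≢j
    ... | no _    | no i≮k  | _       = contradiction i<k i≮k
    ... | no _    | yes _   | no j≮k  = contradiction j<k j≮k
    ... | no _    | yes _   | yes _   =
      Equivalence.from (T-∨ {E i j}) (inj₂ (Equivalence.from T-∧ (eik , ejk)))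

    connect⁻ : T (connectNeighbours k E i j) →
               T (E i j) ⊎ (i Fin.< k × j Fin.< k × T (E i k) × T (E j k))
    connect⁻ e with i ≟ j | i <? k | j <? k | Equivalence.to (T-∨ {E i j}) e
    ... | _     | _       | _       | inj₁ eij = inj₁ eij
    ... | no _  | yes i<k | yes j<k | inj₂ e′  =
      inj₂ (i<k , j<k , Equivalence.to T-∧ e′)

  module _ (E : Matrix Bool n) where

    private
      fill : List (Fin n) → Matrix Bool n
      fill = foldr connectNeighbours E

      fill-⊇ : ∀ xs {i j} → T (E i j) → T (fill xs i j)
      fill-⊇ []       e = e
      fill-⊇ (x ∷ xs) e = connect-⊇ x (fill xs) (fill-⊇ xs e)

      -- Vertices below k do not acquire an edge to k once k is processed.
      fill-closed : ∀ {xs} → AllPairs Fin._<_ xs → ∀ {i j k} → k ∈ˡ xs →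
                    i ≢ j → i Fin.< k → j Fin.< k →
                    T (fill xs i k) → T (fill xs j k) → T (fill xs i j)
      fill-closed {x ∷ xs} (_ ∷ _) (here refl) i≢j i<k j<k eik ejk
        with connect⁻ x (fill xs) eik | connect⁻ x (fill xs) ejk
      ... | inj₁ eik′         | inj₁ ejk′         =
        connect⁺ x (fill xs) i≢j i<k j<k eik′ ejk′
      ... | inj₂ (_ , k<k , _) | _                 = contradiction k<k (<-irrefl refl)
      ... | _                 | inj₂ (_ , k<k , _) = contradiction k<k (<-irrefl refl)
      fill-closed {x ∷ xs} (x< ∷ <s) (there k∈xs) i≢j i<k j<k eik ejk
        with connect⁻ x (fill xs) eik | connect⁻ x (fill xs) ejk
      ... | inj₁ eik′         | inj₁ ejk′         =
        connect-⊇ x (fill xs) (fill-closed <s k∈xs i≢j i<k j<k eik′ ejk′)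
      ... | inj₂ (_ , k<x , _) | _                 =
        contradiction k<x (<-asym (All.lookup x< k∈xs))
      ... | _                 | inj₂ (_ , k<x , _) =
        contradiction k<x (<-asym (All.lookup x< k∈xs))

    triangulate-⊇ : ∀ {i j} → T (E i j) → T (triangulate E i j)
    triangulate-⊇ = fill-⊇ (allFin n)

    triangulate-closed : ∀ {i j k} → i ≢ j → i Fin.< k → j Fin.< k →
                         T (triangulate E i k) → T (triangulate E j k) →
                         T (triangulate E i j)
    triangulate-closed {k = k} = fill-closed (tabulate⁺-< id) (∈-allFin k)

    -- Paths through later vertices

    private
      -- Symmetric in `i` and `j`, with no assumption on which is smaller, so that a detour can be
      -- reversed.
      Inner : Fin n → Fin n → Fin n → Set
      Inner i j v = v ≡ i ⊎ v ≡ j ⊎ (i Fin.< v × j Fin.< v)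

      InnerEdge : Fin n → Fin n → Fin n → Fin n → Set
      InnerEdge i j u v = Inner i j u × Inner i j v × T (E u v)

      Detour : Fin n → Fin n → Set
      Detour i j = Star (InnerEdge i j) i j

      flip-Inner : ∀ {i j v} → Inner i j v → Inner j i v
      flip-Inner (inj₁ v≡i)               = inj₂ (inj₁ v≡i)
      flip-Inner (inj₂ (inj₁ v≡j))        = inj₁ v≡j
      flip-Inner (inj₂ (inj₂ (i<v , j<v))) = inj₂ (inj₂ (j<v , i<v))

    module _ (E-sym : Symmetricᵇ E) where

      private
        reverse-Detour : ∀ {i j} → Detour i j → Detour j i
        reverse-Detour = Star.reverse λ (u , v , e) → flip-Inner v , flip-Inner u , E-sym e

        -- The common end `k` becomes an inner vertex. Inner vertices of the first part exceed `i`
        -- and `k`, hence `j` as well; the second part is symmetric.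
        join-Detour : ∀ {i j k} → i Fin.< k → j Fin.< k → Detour i k → Detour k j →
                      Detour i j
        join-Detour i<k j<k p q =
          Star.map (λ (u , v , e) → left u , left v , e) p ◅◅
          Star.map (λ (u , v , e) → right u , right v , e) q
          where
          left : ∀ {v} → Inner _ _ v → Inner _ _ v
          left (inj₁ v≡i)               = inj₁ v≡i
          left (inj₂ (inj₁ refl))       = inj₂ (inj₂ (i<k , j<k))
          left (inj₂ (inj₂ (i<v , k<v))) =
            inj₂ (inj₂ (i<v , ℕₚ.<-trans j<k k<v))
          right : ∀ {v} → Inner _ _ v → Inner _ _ v
          right (inj₁ refl)              = inj₂ (inj₂ (i<k , j<k))
          right (inj₂ (inj₁ v≡j))        = inj₂ (inj₁ v≡j)
          right (inj₂ (inj₂ (k<v , j<v))) =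
            inj₂ (inj₂ (ℕₚ.<-trans i<k k<v , j<v))

        -- An edge of `fill (x ∷ xs)` was there before or joins two neighbours of `x` below `x`; in
        -- the latter case two detours are glued at `x`.
        detour : ∀ xs {i j} → T (fill xs i j) → Detour i j
        detour []       e = (inj₁ refl , inj₂ (inj₁ refl) , e) ◅ ε
        detour (x ∷ xs) e with connect⁻ x (fill xs) e
        ... | inj₁ e′                       = detour xs e′
        ... | inj₂ (i<k , j<k , eik , ejk) =
          join-Detour i<k j<k (detour xs eik) (reverse-Detour (detour xs ejk))

      -- Every inner vertex of a detour exceeds the larger end `k`, so the whole path stays in the
      -- induced subgraph.
      triangulate⇒E′ : ∀ {j k} → j Fin.< k → T (triangulate E j k) → E′ E k j
      triangulate⇒E′ {j} {k} j<k e =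
        j<k , Star.map (λ (u , v , e) → on u , on v , e)
                       (reverse-Detour (detour (allFin n) e))
        where
        on : ∀ {v} → Inner k j v → InducedOn j k v
        on (inj₁ refl)              = inj₂ ℕₚ.≤-refl
        on (inj₂ (inj₁ v≡j))        = inj₁ v≡j
        on (inj₂ (inj₂ (k<v , _))) = inj₂ (ℕₚ.<⇒≤ k<v)

      -- Edges are counted at their upper ends, and the lower neighbours of `k` in the filled graph
      -- all satisfy `E′ E k`; so each of the `n` summands is at most the width.
      edgeCount≤n*inducedWidth :
        edgeCount (triangulate E) ≤ n * inducedWidth E
      edgeCount≤n*inducedWidth =
        ℕₚ.≤-trans (sum-map-≤ (allFin n) λ {k} _ → degree≤ k)
                   (ℕₚ.≤-reflexive (cong (_* inducedWidth E) (length-tabulate {n = n} id)))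
        where
        degree≤ : ∀ k → degree (triangulate E) k ≤ inducedWidth E
        degree≤ k = ℕₚ.≤-trans
          (ℕₚ.≤-trans (ℕₚ.≤-reflexive (cong length (filter-filter (allFin n))))
            (length-filter-mono _ (E′? E k) (λ (j<k , e) → triangulate⇒E′ j<k e) (allFin n)))
          (All.lookup (xs≤max 0 (map (λ k → length (filter (E′? E k) (allFin n))) (allFin n)))
                      (∈-map⁺ _ (∈-allFin k)))
          where
          -- `degree` filters `allFin n` in two rounds, the width in one; merging the rounds makes
          -- the counts comparable.
          filter-filter : ∀ xs → filter (λ j → T? (triangulate E j k)) (filter (_<? k) xs) ≡
                          filter (λ j → (j <? k) ×-dec T? (triangulate E j k)) xs
          filter-filter []       = refl
          filter-filter (x ∷ xs) with does (x <? k)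
          ... | false = filter-filter xs
          ... | true  with does (T? (triangulate E x k))
          ...   | true  = cong (x ∷_) (filter-filter xs)
          ...   | false = filter-filter xs

  -- Every vertex is an endpoint of an edge, and m edges have 2 m endpoints.
  n≤2*edgeCount : ∀ (E : Matrix Bool n) →
                  (∀ v → ∃ λ u → u ≢ v × T (E u v) × T (E v u)) →
                  n ≤ edgeCount E + edgeCount E
  n≤2*edgeCount E covered = ℕₚ.≤-trans (∀∈⇒≤length _ endpoint)
    (ℕₚ.≤-reflexive (trans (length-++ (concatMap lows (allFin n)))
      (cong₂ _+_ (length-concatMap lows (allFin n))
        (trans (length-concatMap highs (allFin n))
               (sum-cong (λ k → length-map (const k) (lows k)) (allFin n))))))
    where
    lows highs : Fin n → List (Fin n)
    lows    = lower E
    highs k = map (const k) (lows k)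

    sum-cong : ∀ {f g : Fin n → ℕ} → (∀ k → f k ≡ g k) → ∀ xs → sum (map f xs) ≡ sum (map g xs)
    sum-cong f≗g []       = refl
    sum-cong f≗g (x ∷ xs) = cong₂ _+_ (f≗g x) (sum-cong f≗g xs)

    endpoint : ∀ v → v ∈ˡ concatMap lows (allFin n) ++ concatMap highs (allFin n)
    endpoint v with covered v
    ... | u , u≢v , e , e′ with <-cmp u v
    ...   | tri< u<v _ _ = ∈-++⁺ʳ (concatMap lows (allFin n))
      (∈-concatMap⁺ highs (Any.map (λ { refl → ∈-map⁺ (const v) (∈-lower E u<v e) }) (∈-allFin v)))
    ...   | tri≈ _ u≡v _ = contradiction u≡v u≢v
    ...   | tri> _ _ v<u = ∈-++⁺ˡ
      (∈-concatMap⁺ lows (Any.map (λ { refl → ∈-lower E v<u e′ }) (∈-allFin u)))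

-- Cost and outcome of computations that may stop

data Outcome {a f q} {A : Set a} (F : Set f) (Q : A → Set q) : Maybe A → Set (a ⊔ f ⊔ q) where
  stopped  : F → Outcome F Q INCONSISTENT
  returned : ∀ {x} → Q x → Outcome F Q (just x)

-- A Hoare triple with a time bound, which holds also for runs that stop. A stop is justified by a
-- proof of `F`, a returned value by `Q`.
record Runs {a f q} {A : Set a} (F : Set f) (t : ℕ) (Q : A → Set q) (m : Comp A) :
            Set (a ⊔ f ⊔ q) where
  constructor _,_
  field
    cost    : proj₁ m ≤ t
    outcome : Outcome F Q (proj₂ m)

module _ {f} {F : Set f} where

  weaken : ∀ {a p q} {A : Set a} {P : A → Set p} {Q : A → Set q} {s t m} →
           s ≤ t → (∀ {x} → P x → Q x) → Runs F s P m → Runs F t Q m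
  weaken s≤t P⊆Q (c , stopped e)  = ℕₚ.≤-trans c s≤t , stopped e
  weaken s≤t P⊆Q (c , returned p) = ℕₚ.≤-trans c s≤t , returned (P⊆Q p)

  infixl 1 _then_

  _then_ : ∀ {a b p q} {A : Set a} {B : Set b} {P : A → Set p} {Q : B → Set q}
             {s t} {m : Comp A} {g : A → Comp B} →
           Runs F s P m → (∀ {x} → P x → Runs F t Q (g x)) → Runs F (s + t) Q (m >>= g)
  _then_ {m = _ , nothing} (c , stopped e)  r = ℕₚ.m≤n⇒m≤n+o _ c , stopped e
  _then_ {m = _ , just _}  (c , returned p) r =
    ℕₚ.+-mono-≤ c (Runs.cost (r p)) , Runs.outcome (r p)

  charge : ∀ {a q} {A : Set a} {Q : A → Set q} s {t m} →
           Runs F t Q m → Runs F (s + t) Q (s + proj₁ m , proj₂ m)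
  charge s (c , o) = ℕₚ.+-monoʳ-≤ s c , o

  module _ {a b} {A : Set a} {B : Set b} {body : A → B → Comp B} where

    -- The invariant may speak of the elements still to be visited. The extra 1 in `suc c` is the
    -- step that `for` charges per iteration.
    for-remaining : ∀ {q c} (I : List A → B → Set q) →
      (∀ {x xs s} → I (x ∷ xs) s → Runs F c (I xs) (body x s)) →
      ∀ xs {s} → I xs s → Runs F (length xs * suc c) (I []) (for xs s body)
    for-remaining I step []       i = z≤n , returned i
    for-remaining I step (x ∷ xs) i = charge 1 (step i then for-remaining I step xs)

    -- For loops in which every iteration settles a property `R x` of its own element. `J` is the
    -- plain invariant; `⊑` relates earlier to later states, so that `R x` survives the remaining
    -- iterations.
    for-all : ∀ {j r ℓ c} (J : B → Set j) (R : A → B → Set r) (_⊑_ : B → B → Set ℓ) →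
      (∀ {s} → s ⊑ s) → (∀ {s s′ s″} → s ⊑ s′ → s′ ⊑ s″ → s ⊑ s″) →
      (∀ {x s s′} → s ⊑ s′ → R x s → R x s′) →
      ∀ xs → (∀ {x s} → x ∈ˡ xs → J s →
              Runs F c (λ s′ → J s′ × s ⊑ s′ × R x s′) (body x s)) →
      ∀ {s} → J s →
      Runs F (length xs * suc c)
        (λ s′ → J s′ × s ⊑ s′ × (∀ {x} → x ∈ˡ xs → R x s′)) (for xs s body)
    for-all J R _⊑_ ⊑-refl ⊑-trans R-mono = go
      where
      go : ∀ xs → _ → ∀ {s} → J s → Runs F _ _ (for xs s body)
      go []       step j = z≤n , returned (j , ⊑-refl , λ ())
      go (x ∷ xs) step j =
        charge 1 (step (here refl) j then λ (j₁ , s⊑s₁ , r) →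
          weaken ℕₚ.≤-refl
            (λ (j₂ , s₁⊑s₂ , rs) → j₂ , ⊑-trans s⊑s₁ s₁⊑s₂ ,
              λ { (here refl) → R-mono s₁⊑s₂ r ; (there x∈xs) → rs x∈xs })
            (go xs (step ∘ there) j₁))

    -- Time bounds may differ between elements. The induction is on `n`, so the invariant, indexed
    -- by the number of visited elements, is shifted along with `f`.
    for-ascending : ∀ {n q} (f : Fin n → A) (t : A → ℕ) (I : ℕ → B → Set q) →
      (∀ i {s} → I (toℕ i) s → Runs F (t (f i)) (I (suc (toℕ i))) (body (f i) s)) →
      ∀ {s} → I 0 s →
      Runs F (sum (map (suc ∘ t) (tabulate f))) (I n) (for (tabulate f) s body)
    for-ascending {zero}  f t I step i = z≤n , returned i
    for-ascending {suc n} f t I step i =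
      charge 1 (step Fin.zero i then for-ascending (f ∘ Fin.suc) t (I ∘ suc) (step ∘ Fin.suc))

    for-++ : ∀ xs {ys s} →
             for (xs ++ ys) s body ≡ (for xs s body >>= λ s′ → for ys s′ body)
    for-++ []                = refl
    for-++ (x ∷ xs) {ys} {s} with body x s
    ... | c , nothing = refl
    ... | c , just s′ rewrite for-++ xs {ys} {s′} with for xs s′ body
    ...   | d , nothing = refl
    ...   | d , just s″ =
      cong (λ t → suc t , proj₂ (for ys s″ body)) (sym (ℕₚ.+-assoc c d _))

    -- Reversal puts `f zero` last: by `for-++` the other elements run first and leave the invariant
    -- at 1.
    for-descending : ∀ {n q} (f : Fin n → A) (t : A → ℕ) (I : ℕ → B → Set q) →
      (∀ i {s} → I (suc (toℕ i)) s → Runs F (t (f i)) (I (toℕ i)) (body (f i) s)) →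
      ∀ {s} → I n s →
      Runs F (sum (map (suc ∘ t) (tabulate f))) (I 0) (for (reverse (tabulate f)) s body)
    for-descending {zero}  f t I step i = z≤n , returned i
    for-descending {suc n} f t I step {s} i
      rewrite unfold-reverse (f Fin.zero) (tabulate (f ∘ Fin.suc))
            | for-++ (reverse (tabulate (f ∘ Fin.suc))) {f Fin.zero ∷ []} {s} =
      weaken (ℕₚ.≤-reflexive (trans (cong (rest +_) (ℕₚ.+-identityʳ _)) (ℕₚ.+-comm rest _))) id
        (for-descending (f ∘ Fin.suc) t (I ∘ suc) (step ∘ Fin.suc) i then λ i₁ →
         charge 1 (step Fin.zero i₁ then λ i₀ → z≤n , returned i₀))
      where
      rest : ℕ
      rest = sum (map (suc ∘ t) (tabulate (f ∘ Fin.suc)))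

  -- Each hit is put in front, which reverses the order; the invariant adds the hits still to come
  -- in the same manner. An iteration costs at most 3 steps: loop, read and insertion.
  lowerNeighbours-runs : ∀ {n} (E : Matrix Bool n) k →
    Runs F (length (below k) * 3) (_≡ reverse (lower E k)) (lowerNeighbours E k)
  lowerNeighbours-runs E k =
    for-remaining (λ js ns → filter E? js ʳ++ ns ≡ reverse (lower E k)) scan (below k) refl
    where
    E? = λ j → T? (E j k)
    scan : ∀ {j js ns} → filter E? (j ∷ js) ʳ++ ns ≡ reverse (lower E k) →
           Runs F 2 (λ ns′ → filter E? js ʳ++ ns′ ≡ reverse (lower E k))
             (read E j k >>= λ e → if e then step (j ∷ ns) else return ns)
    scan {j} eq with E j k
    ... | true  = ℕₚ.≤-refl , returned eq
    ... | false = s≤s z≤n , returned eq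

-- Extended weights and distances

module _ {a} {A : Set a} {n : ℕ} (i j : Fin n) (x : A) (M : Matrix A n) where

  update : Matrix A n
  update = updateAt M i λ row → updateAt row j (const x)

  update-at : update i j ≡ x
  update-at rewrite updateAt-updates i {λ row → updateAt row j (const x)} M =
    updateAt-updates j (M i)

  update-off : ∀ {u v} → ¬ (u ≡ i × v ≡ j) → update u v ≡ M u v
  update-off {u} {v} off with u ≟ i
  ... | no u≢i rewrite updateAt-minimal u i {λ row → updateAt row j (const x)} M u≢i = refl
  ... | yes refl rewrite updateAt-updates i {λ row → updateAt row j (const x)} M =
    updateAt-minimal v j (M i) λ v≡j → off (refl , v≡j)

  update-elim : ∀ {p} (P : A → Set p) {u v} → (u ≡ i → v ≡ j → P x) → P (M u v) →
                P (update u v)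
  update-elim P {u} {v} new old with u ≟ i | v ≟ j
  ... | yes refl | yes refl = subst P (sym update-at) (new refl refl)
  ... | no u≢i   | _        = subst P (sym (update-off (u≢i ∘ proj₁))) old
  ... | _        | no v≢j   = subst P (sym (update-off (v≢j ∘ proj₂))) old

module Weights {c ℓ₁ ℓ₂} (W : DecTotallyOrderedAbelianGroup c ℓ₁ ℓ₂) where

  open DecTotallyOrderedAbelianGroup W renaming (_+_ to _+ʷ_) public
  open Weighted W public
  private
    module + = IsAbelianGroup isAbelianGroup
    module ≤ = IsDecTotalOrder isDecTotalOrder

  open AddSupremumEquality _≈_ public using (_≈⁺_; ⊤⁺≈⊤⁺; [_])
  open AddSupremum _≤ʷ_ public using (_≤⁺_; _≤⊤⁺; [_]; ≤⁺-isPartialOrder; [≤]-injective)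

  ≤⁺-poset : Poset _ _ _
  ≤⁺-poset = record { isPartialOrder = ≤⁺-isPartialOrder ≤.isPartialOrder }

  open Poset ≤⁺-poset public using ()
    renaming (refl to ≤⁺-refl; trans to ≤⁺-trans; reflexive to ≤⁺-reflexive)

  ≮0⇒0≤ : ∀ {x} → ¬ (x <ʷ 0#) → 0# ≤ʷ x
  ≮0⇒0≤ = NonStrictToStrict.≮⇒≥ _≈_ _≤ʷ_ ≤.Eq.sym _≟ʷ_ ≤.reflexive ≤.total

  <0⇒0≰ : ∀ {x} → x <ʷ 0# → ¬ (0# ≤ʷ x)
  <0⇒0≰ (x≤0 , x≉0) 0≤x = x≉0 (≤.antisym x≤0 0≤x)

  +ʷ-mono : ∀ {x y u v} → x ≤ʷ y → u ≤ʷ v → (x +ʷ u) ≤ʷ (y +ʷ v)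
  +ʷ-mono {x} {y} {u} {v} x≤y u≤v = ≤.trans (+-monoʳ-≤ x u≤v)
    (≤.trans (≤.reflexive (+.comm x v))
      (≤.trans (+-monoʳ-≤ v x≤y) (≤.reflexive (+.comm v y))))

  +⁺-mono : ∀ {x y u v} → x ≤⁺ y → u ≤⁺ v → x +⁺ u ≤⁺ y +⁺ v
  +⁺-mono [ p ]   [ q ]     = [ +ʷ-mono p q ]
  +⁺-mono [ _ ]   (_ ≤⊤⁺) = _ ≤⊤⁺
  +⁺-mono (_ ≤⊤⁺) _       = _ ≤⊤⁺

  +⁺-monoˡ : ∀ {x y u} → x ≤⁺ y → x +⁺ u ≤⁺ y +⁺ u
  +⁺-monoˡ x≤y = +⁺-mono x≤y ≤⁺-refl

  +⁺-monoʳ : ∀ x {u v} → u ≤⁺ v → x +⁺ u ≤⁺ x +⁺ v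
  +⁺-monoʳ x = +⁺-mono {x} ≤⁺-refl

  +⁺-assoc : ∀ x y z → (x +⁺ y) +⁺ z ≈⁺ x +⁺ (y +⁺ z)
  +⁺-assoc [ x ] [ y ] [ z ] = [ +.assoc x y z ]
  +⁺-assoc [ x ] [ y ] ⊤⁺    = ⊤⁺≈⊤⁺
  +⁺-assoc [ x ] ⊤⁺    z     = ⊤⁺≈⊤⁺
  +⁺-assoc ⊤⁺    y     z     = ⊤⁺≈⊤⁺

  +⁺-comm : ∀ x y → x +⁺ y ≈⁺ y +⁺ x
  +⁺-comm [ x ] [ y ] = [ +.comm x y ]
  +⁺-comm [ x ] ⊤⁺    = ⊤⁺≈⊤⁺
  +⁺-comm ⊤⁺    [ y ] = ⊤⁺≈⊤⁺
  +⁺-comm ⊤⁺    ⊤⁺    = ⊤⁺≈⊤⁺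

  +⁺-identityˡ : ∀ x → [ 0# ] +⁺ x ≈⁺ x
  +⁺-identityˡ [ x ] = [ +.identityˡ x ]
  +⁺-identityˡ ⊤⁺    = ⊤⁺≈⊤⁺

  +⁺-identityʳ : ∀ x → x +⁺ [ 0# ] ≈⁺ x
  +⁺-identityʳ [ x ] = [ +.identityʳ x ]
  +⁺-identityʳ ⊤⁺    = ⊤⁺≈⊤⁺

  ≤+⁺⊤⁺ : ∀ {x} y → x ≤⁺ y +⁺ ⊤⁺
  ≤+⁺⊤⁺ [ _ ] = _ ≤⊤⁺
  ≤+⁺⊤⁺ ⊤⁺    = _ ≤⊤⁺

  min⁺-sel : ∀ x y → min⁺ x y ≡ x ⊎ min⁺ x y ≡ y
  min⁺-sel ⊤⁺    y     = inj₂ refl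
  min⁺-sel [ x ] ⊤⁺    = inj₁ refl
  min⁺-sel [ x ] [ y ] with x ≤ʷ? y
  ... | yes _ = inj₁ refl
  ... | no  _ = inj₂ refl

  min⁺-elim : ∀ {p} (P : Carrier ⁺ → Set p) {x y} → P x → P y → P (min⁺ x y)
  min⁺-elim P {x} {y} px py with min⁺-sel x y
  ... | inj₁ eq = subst P (sym eq) px
  ... | inj₂ eq = subst P (sym eq) py

  min⁺≤ˡ : ∀ x y → min⁺ x y ≤⁺ x
  min⁺≤ˡ ⊤⁺    y     = y ≤⊤⁺
  min⁺≤ˡ [ x ] ⊤⁺    = ≤⁺-refl
  min⁺≤ˡ [ x ] [ y ] with x ≤ʷ? y | ≤.total x y
  ... | yes _  | _        = ≤⁺-refl
  ... | no x≰y | inj₁ x≤y = contradiction x≤y x≰y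
  ... | no _   | inj₂ y≤x = [ y≤x ]

  min⁺≤ʳ : ∀ x y → min⁺ x y ≤⁺ y
  min⁺≤ʳ ⊤⁺    y     = ≤⁺-refl
  min⁺≤ʳ [ x ] ⊤⁺    = _ ≤⊤⁺
  min⁺≤ʳ [ x ] [ y ] with x ≤ʷ? y
  ... | yes x≤y = [ x≤y ]
  ... | no _    = ≤⁺-refl

  negative⁺-false : ∀ x → negative⁺ x ≡ false → [ 0# ] ≤⁺ x
  negative⁺-false ⊤⁺    _  = _ ≤⊤⁺
  negative⁺-false [ x ] eq with x <ʷ? 0#
  ... | no x≮0 = [ ≮0⇒0≤ x≮0 ]

  negative⁺-true : ∀ x → negative⁺ x ≡ true → ∃ λ y → x ≡ [ y ] × y <ʷ 0#
  negative⁺-true [ x ] eq with x <ʷ? 0#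
  ... | yes x<0 = x , refl , x<0

  module _ {n : ℕ} where

    relaxed : Fin n → Fin n → Carrier ⁺ → Carrier ⁺ → Matrix (Carrier ⁺) n →
              Matrix (Carrier ⁺) n
    relaxed i j x y M = update i j (min⁺ (M i j) (x +⁺ y)) M

    module _ (i j : Fin n) (x y : Carrier ⁺) (M : Matrix (Carrier ⁺) n) where

      relaxed-≤ : ∀ u v → relaxed i j x y M u v ≤⁺ M u v
      relaxed-≤ u v = update-elim i j _ M (_≤⁺ M u v)
        (λ { refl refl → min⁺≤ˡ (M i j) (x +⁺ y) }) ≤⁺-refl

      relaxed-at : relaxed i j x y M i j ≤⁺ x +⁺ y
      relaxed-at rewrite update-at i j (min⁺ (M i j) (x +⁺ y)) M = min⁺≤ʳ (M i j) (x +⁺ y)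

      relaxed-off : ∀ {u v} → ¬ (u ≡ i × v ≡ j) → relaxed i j x y M u v ≡ M u v
      relaxed-off = update-off i j _ M

      relaxed-elim : ∀ {p} (P : Fin n → Fin n → Carrier ⁺ → Set p) {u v} →
                     P i j (x +⁺ y) → P u v (M u v) → P u v (relaxed i j x y M u v)
      relaxed-elim P {u} {v} new old = update-elim i j _ M (P u v)
        (λ { refl refl → min⁺-elim (P i j) old new }) old

  -- Paths, their weights and distances

  module Distances {V : Set} (G : Graph V) where

    open Graph G public

    weight-◅◅ : ∀ {u v t} (p : Path u v) (q : Path v t) →
                weight (p ◅◅ q) ≈ weight p +ʷ weight q
    weight-◅◅ ε             q = +.sym (+.identityˡ _)
    weight-◅◅ ((x , _) ◅ p) q =
      +.trans (+.∙-congˡ (weight-◅◅ p q)) (+.sym (+.assoc x _ _))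

    -- Vacuous at infinity: only a finite value has to be the weight of a path, up to `≈`.
    Realised : V → V → Carrier ⁺ → Set _
    Realised u v m = ∀ {x} → m ≡ [ x ] → Σ (Path u v) λ p → weight p ≈ x

    realised-arc : ∀ u v → Realised u v (arc u v)
    realised-arc u v {x} eq = (x , eq) ◅ ε , +.identityʳ x

    realised-0 : ∀ {u} → Realised u u [ 0# ]
    realised-0 refl = ε , +.refl

    realised-+⁺ : ∀ {u v t x y} → Realised u v x → Realised v t y → Realised u t (x +⁺ y)
    realised-+⁺ {x = [ _ ]} {[ _ ]} rx ry refl with rx refl | ry refl
    ... | p , p≈ | q , q≈ = p ◅◅ q , +.trans (weight-◅◅ p q) (+.∙-cong p≈ q≈)

    realised-<0 : ∀ {u m x} → Realised u u m → m ≡ [ x ] → x <ʷ 0# → NegativeCycle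
    realised-<0 r eq (x≤0 , x≉0) with r eq
    ... | p , p≈ =
      _ , p , ≤.trans (≤.reflexive p≈) x≤0 , λ p≈0 → x≉0 (+.trans (+.sym p≈) p≈0)

    realised-negative : ∀ {u m} → Realised u u m → negative⁺ m ≡ true → NegativeCycle
    realised-negative {m = m} r neg =
      let (x , eq , x<0) = negative⁺-true m neg in realised-<0 r eq x<0

    two-cycle⇒cycle : NegativeTwoCycle → NegativeCycle
    two-cycle⇒cycle (u , v , (x , eq) , (y , eq′) , neg) =
      realised-<0 (realised-+⁺ (realised-arc u v) (realised-arc v u)) (cong₂ _+⁺_ eq eq′) neg

    no-negative-two-cycle : ¬ NegativeTwoCycle → ∀ u v → [ 0# ] ≤⁺ arc u v +⁺ arc v u
    no-negative-two-cycle ¬neg u v with arc u v in eq-uv | arc v u in eq-vu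
    ... | [ x ] | [ y ] = [ ≮0⇒0≤ (λ neg → ¬neg (u , v , (x , eq-uv) , (y , eq-vu) , neg)) ]
    ... | [ x ] | ⊤⁺    = _ ≤⊤⁺
    ... | ⊤⁺    | _     = _ ≤⊤⁺

    module _ {D : V → V → Carrier ⁺}
             (diagonal : ∀ u → D u u ≡ [ 0# ]) (≤arc : ∀ u v → D u v ≤⁺ arc u v)
             (triangle : ∀ u v t → D u t ≤⁺ D u v +⁺ D v t) where

      -- Induction along the path: `≤arc` bounds the first arc, and the triangle inequality attaches
      -- the rest. Absence of negative cycles is a consequence, as a cycle at `v` weighs at least
      -- `D v v`.
      ≤weight : ∀ {u v} (p : Path u v) → D u v ≤⁺ [ weight p ]
      ≤weight {u} ε = ≤⁺-reflexive (Poset.Eq.reflexive ≤⁺-poset (diagonal u))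
      ≤weight {u} {v} (_◅_ {j = t} (x , eq) p) = ≤⁺-trans (triangle u t v)
        (+⁺-mono (subst (D u t ≤⁺_) eq (≤arc u t)) (≤weight p))

      no-negative-cycle : ¬ NegativeCycle
      no-negative-cycle (v , p , neg) =
        <0⇒0≰ neg ([≤]-injective (subst (_≤⁺ [ weight p ]) (diagonal v) (≤weight p)))

      -- A finite entry is attained by a path and bounds all others from below; next to an infinite
      -- entry, a path of finite weight would be absurd.
      isDistance : (∀ u v → Realised u v (D u v)) → ∀ u v → IsDistance u v (D u v)
      isDistance realised u v with D u v in eq
      ... | [ x ] = let (p , p≈) = realised u v eq in
        shortest p p≈ λ q → [≤]-injective (subst (_≤⁺ [ weight q ]) eq (≤weight q))
      ... | ⊤⁺    = unreachable λ p → absurd (subst (_≤⁺ [ weight p ]) eq (≤weight p))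
        where
        absurd : ∀ {x} → ¬ (⊤⁺ ≤⁺ [ x ])
        absurd ()

-- DPC

module DPC {c ℓ₁ ℓ₂} (W : DecTotallyOrderedAbelianGroup c ℓ₁ ℓ₂)
           {n : ℕ} (G : Weighted.Graph W (Fin n)) where

  open Weights W public
  open Distances G public

  Filled : Matrix Bool n
  Filled = triangulate edge

  edge-sym : Symmetricᵇ edge
  edge-sym {i} {j} e with is-just (arc i j) | is-just (arc j i)
  ... | true  | true  = _
  ... | true  | false = _
  ... | false | true  = _

  -- `within` feeds the time bound, the other fields the correctness proof. An edge may carry two
  -- infinite weights, but by `covered` a finite weight always comes with its edge.
  record Sound (N : Network n) : Set (c ⊔ ℓ₁ ⊔ ℓ₂) where
    E = proj₁ N
    w = proj₂ N
    field
      within   : ∀ u v → T (E u v) → T (Filled u v)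
      covered  : ∀ u v → T (is-just (w u v)) → T (E u v) × T (E v u)
      realised : ∀ u v → Realised u v (w u v)
      ≤arc     : ∀ u v → w u v ≤⁺ arc u v
      0≤cycle  : ¬ NegativeTwoCycle → ∀ u v → [ 0# ] ≤⁺ w u v +⁺ w v u

  sound-network : Sound (network G)
  sound-network = record
    { within   = λ u v → triangulate-⊇ edge
    ; covered  = λ u v fin → let e = Equivalence.from T-∨ (inj₁ fin) in e , edge-sym {u} {v} e
    ; realised = realised-arc
    ; ≤arc     = λ u v → ≤⁺-refl
    ; 0≤cycle  = no-negative-two-cycle
    }

  Triangle : Fin n → Fin n → Fin n → Network n → Set _
  Triangle k i j (_ , w) = w i j ≤⁺ w i k +⁺ w k j × w j i ≤⁺ w j k +⁺ w k i

  -- Relates two states during the elimination of `k`. Rows and columns from `k` on are frozen, so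
  -- inequalities with right-hand sides there remain valid.
  record Refines (k : Fin n) (N N′ : Network n) : Set (c ⊔ ℓ₂) where
    field
      decrease : ∀ u v → proj₂ N′ u v ≤⁺ proj₂ N u v
      fixedᴱ   : ∀ u v → k Fin.≤ u ⊎ k Fin.≤ v → proj₁ N′ u v ≡ proj₁ N u v
      fixedʷ   : ∀ u v → k Fin.≤ u ⊎ k Fin.≤ v → proj₂ N′ u v ≡ proj₂ N u v

  module _ {k : Fin n} where

    refines-refl : ∀ {N} → Refines k N N
    refines-refl = record
      { decrease = λ u v → ≤⁺-refl
      ; fixedᴱ   = λ u v _ → refl
      ; fixedʷ   = λ u v _ → refl
      }

    refines-trans : ∀ {N N′ N″} → Refines k N N′ → Refines k N′ N″ → Refines k N N″
    refines-trans r r′ = record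
      { decrease = λ u v → ≤⁺-trans (r′ .decrease u v) (r .decrease u v)
      ; fixedᴱ   = λ u v ≥k → trans (r′ .fixedᴱ u v ≥k) (r .fixedᴱ u v ≥k)
      ; fixedʷ   = λ u v ≥k → trans (r′ .fixedʷ u v ≥k) (r .fixedʷ u v ≥k)
      }
      where open Refines

    -- The left side can only have decreased; the right side lies in row and column `k′` and has not
    -- changed.
    refines-≤+⁺ : ∀ {N N′} → Refines k N N′ → ∀ {k′ i j} → k Fin.≤ k′ →
                  proj₂ N i j ≤⁺ proj₂ N i k′ +⁺ proj₂ N k′ j →
                  proj₂ N′ i j ≤⁺ proj₂ N′ i k′ +⁺ proj₂ N′ k′ j
    refines-≤+⁺ {N} {N′} r {k′} {i} {j} k≤k′ tri
      rewrite Refines.fixedʷ r i k′ (inj₂ k≤k′) | Refines.fixedʷ r k′ j (inj₁ k≤k′) =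
      ≤⁺-trans (Refines.decrease r i j) tri

    refines-triangle : ∀ {i j N N′} → Refines k N N′ → Triangle k i j N → Triangle k i j N′
    refines-triangle r (t₁ , t₂) =
      refines-≤+⁺ r ℕₚ.≤-refl t₁ , refines-≤+⁺ r ℕₚ.≤-refl t₂

  module Connect {E : Matrix Bool n} {w : Matrix (Carrier ⁺) n} (s : Sound (E , w)) {i j k : Fin n}
                 (i<j : i Fin.< j) (i<k : i Fin.< k) (j<k : j Fin.< k)
                 (eik : T (Filled i k)) (ejk : T (Filled j k)) where

    open Sound s hiding (E; w)

    private
      w₁ w₂ : Matrix (Carrier ⁺) n
      w₁ = relaxed i j (w i k) (w k j) w
      w₂ = relaxed j i (w₁ j k) (w₁ k i) w₁

      E₁ E₂ : Matrix Bool n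
      E₁ = update i j true E
      E₂ = update j i true E₁

      i≢j : i ≢ j
      i≢j refl = <-irrefl refl i<j

      k∉ : ∀ {u v} → k Fin.≤ u ⊎ k Fin.≤ v → ¬ (u ≡ i × v ≡ j)
      k∉ (inj₁ k≤i) (refl , _) = ℕₚ.<⇒≱ i<k k≤i
      k∉ (inj₂ k≤j) (_ , refl) = ℕₚ.<⇒≱ j<k k≤j

      k∉′ : ∀ {u v} → k Fin.≤ u ⊎ k Fin.≤ v → ¬ (u ≡ j × v ≡ i)
      k∉′ (inj₁ k≤j) (refl , _) = ℕₚ.<⇒≱ j<k k≤j
      k∉′ (inj₂ k≤i) (_ , refl) = ℕₚ.<⇒≱ i<k k≤i

      realised₁ : ∀ u v → Realised u v (w₁ u v)
      realised₁ u v = relaxed-elim i j (w i k) (w k j) w Realised {u} {v}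
        (realised-+⁺ (realised i k) (realised k j)) (realised u v)

      realised₂ : ∀ u v → Realised u v (w₂ u v)
      realised₂ u v = relaxed-elim j i (w₁ j k) (w₁ k i) w₁ Realised {u} {v}
        (realised-+⁺ (realised₁ j k) (realised₁ k i)) (realised₁ u v)

      refines : Refines k (E , w) (E₂ , w₂)
      refines = record
        { decrease = λ u v → ≤⁺-trans (relaxed-≤ j i _ _ w₁ u v) (relaxed-≤ i j _ _ w u v)
        ; fixedᴱ   = λ u v ≥k →
            trans (update-off j i true E₁ (k∉′ ≥k)) (update-off i j true E (k∉ ≥k))
        ; fixedʷ   = λ u v ≥k →
            trans (relaxed-off j i _ _ w₁ (k∉′ ≥k)) (relaxed-off i j _ _ w (k∉ ≥k))
        }

      triangle : Triangle k i j (E₂ , w₂)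
      triangle
        rewrite Refines.fixedʷ refines i k (inj₂ ℕₚ.≤-refl)
              | Refines.fixedʷ refines k j (inj₁ ℕₚ.≤-refl)
              -- The second relaxation reads `w₁`, so the right side of the second inequality is
              -- brought back to `w₁` only.
              | relaxed-off j i (w₁ j k) (w₁ k i) w₁ (k∉′ {j} {k} (inj₂ ℕₚ.≤-refl))
              | relaxed-off j i (w₁ j k) (w₁ k i) w₁ (k∉′ {k} {i} (inj₁ ℕₚ.≤-refl)) =
        ≤⁺-trans (relaxed-≤ j i _ _ w₁ i j) (relaxed-at i j _ _ w) , relaxed-at j i _ _ w₁

      -- `covered` and `0≤cycle` involve both orientations of a pair; this separates the pair just
      -- written, in either orientation, from all others.
      pair? : ∀ u v → (u ≡ i × v ≡ j) ⊎ (u ≡ j × v ≡ i) ⊎ (¬ (u ≡ i × v ≡ j) × ¬ (u ≡ j × v ≡ i))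
      pair? u v with u ≟ i | v ≟ j | u ≟ j | v ≟ i
      ... | yes u≡i | yes v≡j | _       | _       = inj₁ (u≡i , v≡j)
      ... | _       | _       | yes u≡j | yes v≡i = inj₂ (inj₁ (u≡j , v≡i))
      ... | no u≢i  | _       | no u≢j  | _       = inj₂ (inj₂ (u≢i ∘ proj₁ , u≢j ∘ proj₁))
      ... | no u≢i  | _       | yes _   | no v≢i  = inj₂ (inj₂ (u≢i ∘ proj₁ , v≢i ∘ proj₂))
      ... | yes _   | no v≢j  | no u≢j  | _       = inj₂ (inj₂ (v≢j ∘ proj₂ , u≢j ∘ proj₁))
      ... | yes _   | no v≢j  | yes _   | no v≢i  = inj₂ (inj₂ (v≢j ∘ proj₂ , v≢i ∘ proj₂))

      unchanged : ∀ {u v} → ¬ (u ≡ i × v ≡ j) → ¬ (u ≡ j × v ≡ i) → w₂ u v ≡ w u v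
      unchanged off off′ = trans (relaxed-off j i _ _ w₁ off′) (relaxed-off i j _ _ w off)

      E⊆E₂ : ∀ u v → T (E u v) → T (E₂ u v)
      E⊆E₂ u v e = update-elim j i true E₁ T (λ _ _ → _) (update-elim i j true E T (λ _ _ → _) e)

      E₂ij : T (E₂ i j)
      E₂ij = update-elim j i true E₁ T (λ _ _ → _) (subst T (sym (update-at i j true E)) _)

      E₂ji : T (E₂ j i)
      E₂ji = subst T (sym (update-at j i true E₁)) _

      sound : [ 0# ] ≤⁺ w₂ i j +⁺ w₂ j i → Sound (E₂ , w₂)
      sound 0≤ = record
        -- A new edge lies in `Filled`, because `i` and `j` are both adjacent to `k` there.
        { within   = λ u v → update-elim j i true E₁ (λ b → T b → T (Filled u v))
            (λ { refl refl _ → triangulate-closed edge (i≢j ∘ sym) j<k i<k ejk eik })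
            (update-elim i j true E (λ b → T b → T (Filled u v))
              (λ { refl refl _ → triangulate-closed edge i≢j i<k j<k eik ejk })
              (within u v))
        ; covered  = covered₂
        ; realised = realised₂
        ; ≤arc     = λ u v → ≤⁺-trans (Refines.decrease refines u v) (≤arc u v)
        ; 0≤cycle  = 0≤cycle₂
        }
        where
        covered₂ : ∀ u v → T (is-just (w₂ u v)) → T (E₂ u v) × T (E₂ v u)
        covered₂ u v fin with pair? u v
        ... | inj₁ (refl , refl)        = E₂ij , E₂ji
        ... | inj₂ (inj₁ (refl , refl)) = E₂ji , E₂ij
        ... | inj₂ (inj₂ (off , off′))  =
          let (e , e′) = covered u v (subst (T ∘ is-just) (unchanged off off′) fin)
          in E⊆E₂ u v e , E⊆E₂ v u e′

        0≤cycle₂ : ¬ NegativeTwoCycle → ∀ u v → [ 0# ] ≤⁺ w₂ u v +⁺ w₂ v u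
        0≤cycle₂ ¬neg u v with pair? u v
        ... | inj₁ (refl , refl)        = 0≤
        ... | inj₂ (inj₁ (refl , refl)) = ≤⁺-trans 0≤ (≤⁺-reflexive (+⁺-comm (w₂ i j) (w₂ j i)))
        ... | inj₂ (inj₂ (off , off′))
          rewrite unchanged off off′
                | unchanged {v} {u} (λ (p , q) → off′ (q , p)) (λ (p , q) → off (q , p)) =
          0≤cycle ¬neg u v

    -- A negative sum is realised by a closed path, which justifies the stop. A returning run costs
    -- 18 steps; `stop` adds one.
    connect-runs : Runs NegativeCycle 19
      (λ N′ → Sound N′ × Refines k (E , w) N′ × Triangle k i j N′) (connect k i j (E , w))
    connect-runs with negative⁺ (w₂ i j +⁺ w₂ j i) in neg
    ... | true  = ℕₚ.≤-refl , stopped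
      (realised-negative (realised-+⁺ (realised₂ i j) (realised₂ j i)) neg)
    ... | false = ℕₚ.n≤1+n 18 , returned
      (sound (negative⁺-false (w₂ i j +⁺ w₂ j i) neg) , refines , triangle)

  -- The bound `m` is a natural number in order to start at `n`, where nothing is claimed. Equal
  -- neighbours are left to `0≤cycle`.
  Closed : ℕ → Network n → Set _
  Closed m (E , w) = ∀ {i j k} → m ≤ toℕ k → i ≢ j → i Fin.< k → j Fin.< k →
                     T (E i k) → T (E j k) → w i j ≤⁺ w i k +⁺ w k j

  -- An innermost iteration costs 21 steps in DPC and 13 in Snowball, so one bound
  -- serves both passes over the vertices.
  stepCost : Fin n → ℕ
  stepCost k = n * 3 + degree Filled k * suc (n * 21)

  passCost : ℕ
  passCost = sum (map (suc ∘ stepCost) (allFin n))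

  scan-cost : ∀ {E} → (∀ u v → T (E u v) → T (Filled u v)) → ∀ k {t} → t ≤ n * 21 →
              length (reverse (lower E k)) * suc t ≤ degree Filled k * suc (n * 21)
  scan-cost {E} E⊆ k t≤ = ℕₚ.*-mono-≤
    (ℕₚ.≤-trans (ℕₚ.≤-reflexive (length-reverse (lower E k)))
      (length-filter-mono (λ j → T? (E j k)) (λ j → T? (Filled j k)) (λ {j} → E⊆ j k) (below k)))
    (s≤s t≤)

  dpc-runs : Runs NegativeCycle passCost (λ N → Sound N × Closed 0 N) (dpc (network G))
  dpc-runs = for-descending id stepCost (λ m N → Sound N × Closed m N) eliminate
    (sound-network , λ {i} {j} {k} n≤k → contradiction n≤k (ℕₚ.<⇒≱ (toℕ<n k)))
    where
    eliminate : ∀ k {N} → Sound N × Closed (suc (toℕ k)) N →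
                Runs NegativeCycle (stepCost k) (λ N′ → Sound N′ × Closed (toℕ k) N′) _
    eliminate k {N@(E , w)} (s , closed) =
      weaken (ℕₚ.+-monoˡ-≤ _ (ℕₚ.*-monoˡ-≤ 3 (length-below k))) id
        (lowerNeighbours-runs E k then λ { refl →
          weaken
            (scan-cost (Sound.within s) k (ℕₚ.*-monoˡ-≤ 21 (ℕₚ.≤-trans
              (ℕₚ.≤-reflexive (length-reverse (lower E k))) (length-lower E k))))
            (λ (s′ , r , tri) → s′ , closed′ r tri)
            -- The outer loop fixes the larger neighbour `j`, the inner one tries every `i`;
            -- inequalities once gathered survive by `refines-triangle`.
            (for-all Sound (λ j N′ → ∀ {i} → i ∈ˡ ns → i Fin.< j → Triangle k i j N′)
              (Refines k) refines-refl refines-trans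
              (λ r tri i∈ i<j → refines-triangle r (tri i∈ i<j))
              ns
              (λ {j} j∈ s₁ → for-all Sound (λ i N′ → i Fin.< j → Triangle k i j N′)
                (Refines k) refines-refl refines-trans
                (λ r tri i<j → refines-triangle r (tri i<j))
                ns (pair j∈) s₁)
              s) })
      where
      ns = reverse (lower E k)

      neighbour : ∀ {j} → j ∈ˡ ns → j Fin.< k × T (Filled j k)
      neighbour {j} j∈ = let (j<k , e) = ∈-lower⁻ E (reverse⁻ j∈) in j<k , Sound.within s j k e

      pair : ∀ {j} → j ∈ˡ ns → ∀ {i N} → i ∈ˡ ns → Sound N →
             Runs NegativeCycle 20
               (λ N′ → Sound N′ × Refines k N N′ × (i Fin.< j → Triangle k i j N′))
               (step ⌊ i <? j ⌋ >>= λ i<j → if i<j then connect k i j N else return N)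
      pair {j} j∈ {i} i∈ s₁ with i <? j
      ... | no i≮j  = s≤s z≤n , returned (s₁ , refines-refl , λ i<j → contradiction i<j i≮j)
      ... | yes i<j =
        let (i<k , eik) = neighbour i∈
            (j<k , ejk) = neighbour j∈
        in charge 1 (weaken ℕₚ.≤-refl (λ (s₂ , r , tri) → s₂ , r , λ _ → tri)
                  (Connect.connect-runs s₁ i<j i<k j<k eik ejk))

      closed′ : ∀ {N′} → Refines k N N′ →
                (∀ {j} → j ∈ˡ ns → ∀ {i} → i ∈ˡ ns → i Fin.< j → Triangle k i j N′) →
                Closed (toℕ k) N′
      closed′ r tri {i} {j} {k′} k≤k′ i≢j i<k′ j<k′ eik ejk
        -- Edges to `k′` are unchanged, so the hypotheses speak of the edge set found when `k` was
        -- reached.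
        rewrite Refines.fixedᴱ r i k′ (inj₂ k≤k′) | Refines.fixedᴱ r j k′ (inj₂ k≤k′)
        with ℕₚ.m≤n⇒m<n∨m≡n k≤k′
      ... | inj₁ k<k′ = refines-≤+⁺ r k≤k′ (closed k<k′ i≢j i<k′ j<k′ eik ejk)
      ... | inj₂ k≡k′ with toℕ-injective k≡k′
      ...   | refl with <-cmp i j
                      | reverse⁺ (∈-lower E i<k′ eik) | reverse⁺ (∈-lower E j<k′ ejk)
      -- The pair was treated with the larger vertex in the outer loop, and one visit yields both
      -- directions.
      ...     | tri< i<j _ _ | i∈ | j∈ = proj₁ (tri j∈ i∈ i<j)
      ...     | tri≈ _ i≡j _ | _  | _  = contradiction i≡j i≢j
      ...     | tri> _ _ j<i | i∈ | j∈ = proj₂ (tri i∈ j∈ j<i)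

-- Snowball

module Snowball {c ℓ₁ ℓ₂} (W : DecTotallyOrderedAbelianGroup c ℓ₁ ℓ₂)
                {n : ℕ} (G : Weighted.Graph W (Fin n)) where

  open DPC W G public

  Correct : Matrix (Carrier ⁺) n → Set _
  Correct D = ¬ NegativeTwoCycle →
    ¬ NegativeCycle × (∀ i j → IsDistance i j (D i j))

  -- The propagation of distances

  module Phase {E : Matrix Bool n} {w : Matrix (Carrier ⁺) n}
               (s : Sound (E , w)) (closed : Closed 0 (E , w)) where

    open Sound s hiding (E; w)

    -- The assumption on 2-cycles sits inside `triangle`, because the time bound has to hold for
    -- every input. `fresh` supplies the infinite entries with which the next vertex starts.
    record Stage (m : ℕ) (D : Matrix (Carrier ⁺) n) : Set (c ⊔ ℓ₁ ⊔ ℓ₂) where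
      field
        diagonal  : ∀ i → D i i ≡ [ 0# ]
        realisedᴰ : ∀ i j → Realised i j (D i j)
        fresh     : ∀ i j → i ≢ j → m ≤ toℕ i ⊎ m ≤ toℕ j → D i j ≡ ⊤⁺
        ≤w        : ∀ i j → toℕ i < m → toℕ j < m → i ≢ j → D i j ≤⁺ w i j
        triangle  : ¬ NegativeTwoCycle → ∀ i j l → toℕ i < m → toℕ j < m → toℕ l < m →
                    D i l ≤⁺ D i j +⁺ D j l

    open Stage

    module Extend (D₀ : Matrix (Carrier ⁺) n) (k : Fin n) (st : Stage (toℕ k) D₀) where

      NeighbourOfK : Fin n → Set
      NeighbourOfK j = j Fin.< k × T (E j k)

      -- A new entry is infinite or one of the candidates of its minimum; `Through` is the matching
      -- upper bound. Candidates refer to `D₀`, as entries between earlier vertices no longer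
      -- change.
      In Out : Fin n → Carrier ⁺ → Set c
      In  i x = x ≡ ⊤⁺ ⊎ ∃ λ j → NeighbourOfK j × x ≡ D₀ i j +⁺ w j k
      Out i x = x ≡ ⊤⁺ ⊎ ∃ λ j → NeighbourOfK j × x ≡ w k j +⁺ D₀ j i

      record Partial (D : Matrix (Carrier ⁺) n) : Set (c ⊔ ℓ₁ ⊔ ℓ₂) where
        field
          same : ∀ u v → ¬ (u Fin.< k × v ≡ k) → ¬ (u ≡ k × v Fin.< k) → D u v ≡ D₀ u v
          in⁻  : ∀ {i} → i Fin.< k → In i (D i k)
          out⁻ : ∀ {i} → i Fin.< k → Out i (D k i)
          real : ∀ u v → Realised u v (D u v)

      Through : Fin n → Fin n → Matrix (Carrier ⁺) n → Set _
      Through j i D = D i k ≤⁺ D₀ i j +⁺ w j k × D k i ≤⁺ w k j +⁺ D₀ j i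

      _⊒_ : Matrix (Carrier ⁺) n → Matrix (Carrier ⁺) n → Set _
      D ⊒ D′ = ∀ u v → D′ u v ≤⁺ D u v

      ⊒-trans : ∀ {D D′ D″} → D ⊒ D′ → D′ ⊒ D″ → D ⊒ D″
      ⊒-trans ge ge′ u v = ≤⁺-trans (ge′ u v) (ge u v)

      through-mono : ∀ {j i D D′} → D ⊒ D′ → Through j i D → Through j i D′
      through-mono ge (p , q) = ≤⁺-trans (ge _ k) p , ≤⁺-trans (ge k _) q

      partial₀ : Partial D₀
      partial₀ = record
        { same = λ u v _ _ → refl
        ; in⁻  = λ {i} i<k → inj₁ (fresh st i k (λ { refl → <-irrefl refl i<k }) (inj₂ ℕₚ.≤-refl))
        ; out⁻ = λ {i} i<k → inj₁ (fresh st k i (λ { refl → <-irrefl refl i<k }) (inj₁ ℕₚ.≤-refl))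
        ; real = realisedᴰ st
        }

      same-< : ∀ {D} → Partial D → ∀ {u v} → u Fin.< k → v Fin.< k → D u v ≡ D₀ u v
      same-< p {u} {v} u<k v<k = Partial.same p u v
        (λ { (_ , refl) → <-irrefl refl v<k }) (λ { (refl , _) → <-irrefl refl u<k })

      module Relax {D : Matrix (Carrier ⁺) n} (p : Partial D) {i j : Fin n}
                   (i<k : i Fin.< k) (nb : NeighbourOfK j) where

        open Partial p

        private
          j<k = proj₁ nb

        D₁ D₂ : Matrix (Carrier ⁺) n
        D₁ = relaxed i k (D i j) (w j k) D
        D₂ = relaxed k i (w k j) (D₁ j i) D₁

        k≢ : ∀ {u} → u Fin.< k → k ≢ u
        k≢ u<k refl = <-irrefl refl u<k

        Dij : D i j ≡ D₀ i j
        Dij = same-< p i<k j<k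

        -- The first relaxation wrote in column `k`, and `i` lies below `k`.
        D₁ji : D₁ j i ≡ D₀ j i
        D₁ji = trans (relaxed-off i k _ _ D λ (_ , i≡k) → k≢ i<k (sym i≡k)) (same-< p j<k i<k)

        partial : Partial D₂
        partial = record
          { same = λ u v off off′ →
              trans (relaxed-off k i _ _ D₁ λ { (refl , refl) → off′ (refl , i<k) })
                (trans (relaxed-off i k _ _ D λ { (refl , refl) → off (i<k , refl) })
                  (same u v off off′))
          ; in⁻  = λ {u} u<k → subst (In u)
              (sym (relaxed-off k i _ _ D₁ λ (u≡k , _) → k≢ u<k (sym u≡k)))
              (relaxed-elim i k _ _ D (λ u _ → In u) {u} {k}
                (inj₂ (j , nb , cong (_+⁺ w j k) Dij)) (in⁻ u<k))
          ; out⁻ = λ {u} u<k → relaxed-elim k i _ _ D₁ (λ _ u → Out u) {k} {u}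
              (inj₂ (j , nb , cong (w k j +⁺_) D₁ji))
              (subst (Out u) (sym (relaxed-off i k _ _ D λ (k≡i , _) → k≢ i<k k≡i)) (out⁻ u<k))
          ; real = λ u v → relaxed-elim k i _ _ D₁ Realised {u} {v}
              (realised-+⁺ (realised k j) (real₁ j i)) (real₁ u v)
          }
          where
          real₁ : ∀ u v → Realised u v (D₁ u v)
          real₁ u v = relaxed-elim i k _ _ D Realised {u} {v}
            (realised-+⁺ (real i j) (realised j k)) (real u v)

        decrease : D ⊒ D₂
        decrease u v = ≤⁺-trans (relaxed-≤ k i _ _ D₁ u v) (relaxed-≤ i k _ _ D u v)

        through : Through j i D₂
        through =
          subst (λ x → D₂ i k ≤⁺ x +⁺ w j k) Dij
            (≤⁺-trans (relaxed-≤ k i _ _ D₁ i k) (relaxed-at i k _ _ D)) ,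
          subst (λ x → D₂ k i ≤⁺ w k j +⁺ x) D₁ji (relaxed-at k i _ _ D₁)

      module Complete {D : Matrix (Carrier ⁺) n} (p : Partial D)
                      (through : ∀ {j} → NeighbourOfK j → ∀ {i} → i Fin.< k → Through j i D) where

        open Partial p
        open PosetReasoning ≤⁺-poset

        private
          diag : ∀ i → D i i ≡ [ 0# ]
          diag i = trans (same i i (λ { (i<k , refl) → <-irrefl refl i<k })
                                   (λ { (refl , i<k) → <-irrefl refl i<k })) (diagonal st i)

          in≤ : ∀ {i j} → i Fin.< k → NeighbourOfK j → D i k ≤⁺ D i j +⁺ w j k
          in≤ {i} {j} i<k nb = subst (λ x → D i k ≤⁺ x +⁺ w j k)
            (sym (same-< p i<k (proj₁ nb))) (proj₁ (through nb i<k))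

          out≤ : ∀ {i j} → i Fin.< k → NeighbourOfK j → D k i ≤⁺ w k j +⁺ D j i
          out≤ {i} {j} i<k nb = subst (λ x → D k i ≤⁺ w k j +⁺ x)
            (sym (same-< p (proj₁ nb) i<k)) (proj₂ (through nb i<k))

          in≡ : ∀ {i} → i Fin.< k → D i k ≡ ⊤⁺ ⊎ ∃ λ j → NeighbourOfK j × D i k ≡ D i j +⁺ w j k
          in≡ {i} i<k with in⁻ i<k
          ... | inj₁ eq            = inj₁ eq
          ... | inj₂ (j , nb , eq) =
            inj₂ (j , nb , trans eq (cong (_+⁺ w j k) (sym (same-< p i<k (proj₁ nb)))))

          out≡ : ∀ {i} → i Fin.< k → D k i ≡ ⊤⁺ ⊎ ∃ λ j → NeighbourOfK j × D k i ≡ w k j +⁺ D j i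
          out≡ {i} i<k with out⁻ i<k
          ... | inj₁ eq            = inj₁ eq
          ... | inj₂ (j , nb , eq) =
            inj₂ (j , nb , trans eq (cong (w k j +⁺_) (sym (same-< p (proj₁ nb) i<k))))

          ≤w-< : ∀ {i j} → i Fin.< k → j Fin.< k → i ≢ j → D i j ≤⁺ w i j
          ≤w-< {i} {j} i<k j<k i≢j =
            subst (_≤⁺ w i j) (sym (same-< p i<k j<k)) (≤w st i j i<k j<k i≢j)

          -- If `w i k` is finite, then `i` is itself a lower neighbour of `k` by `covered`, and its
          -- candidate starts with the zero on the diagonal.
          in-w : ∀ {i} → i Fin.< k → D i k ≤⁺ w i k
          in-w {i} i<k with w i k in eq
          ... | ⊤⁺    = _ ≤⊤⁺
          ... | [ x ] = begin
            D i k             ≤⟨ in≤ i<k (i<k , proj₁ (covered i k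
                                   (subst (T ∘ is-just) (sym eq) _))) ⟩
            D i i +⁺ w i k    ≡⟨ cong₂ _+⁺_ (diag i) eq ⟩
            [ 0# ] +⁺ [ x ]   ≈⟨ +⁺-identityˡ [ x ] ⟩
            [ x ]             ∎

          out-w : ∀ {i} → i Fin.< k → D k i ≤⁺ w k i
          out-w {i} i<k with w k i in eq
          ... | ⊤⁺    = _ ≤⊤⁺
          ... | [ x ] = begin
            D k i             ≤⟨ out≤ i<k (i<k , proj₂ (covered k i
                                   (subst (T ∘ is-just) (sym eq) _))) ⟩
            w k i +⁺ D i i    ≡⟨ cong₂ _+⁺_ eq (diag i) ⟩
            [ x ] +⁺ [ 0# ]   ≈⟨ +⁺-identityʳ [ x ] ⟩
            [ x ]             ∎

          split : ∀ {u} → toℕ u < suc (toℕ k) → u Fin.< k ⊎ u ≡ k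
          split u<1+k with ℕₚ.m<1+n⇒m<n∨m≡n u<1+k
          ... | inj₁ u<k = inj₁ u<k
          ... | inj₂ u≡k = inj₂ (toℕ-injective u≡k)

        module _ (¬neg : ¬ NegativeTwoCycle) where

          private
            triangle-< : ∀ {i j l} → i Fin.< k → j Fin.< k → l Fin.< k → D i l ≤⁺ D i j +⁺ D j l
            triangle-< {i} {j} {l} i<k j<k l<k
              rewrite same-< p i<k l<k | same-< p i<k j<k | same-< p j<k l<k =
              triangle st ¬neg i j l i<k j<k l<k

            -- The DPC inequality enters here. It covers distinct neighbours; for equal ones the
            -- round trip over `k` must not be negative, which is `0≤cycle`.
            bridge : ∀ {i j} → NeighbourOfK i → NeighbourOfK j → D i j ≤⁺ w i k +⁺ w k j
            bridge {i} {j} (i<k , eik) (j<k , ejk) with i ≟ j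
            ... | yes refl = subst (_≤⁺ w i k +⁺ w k i) (sym (diag i)) (0≤cycle ¬neg i k)
            ... | no i≢j   = ≤⁺-trans (≤w-< i<k j<k i≢j) (closed z≤n i≢j i<k j<k eik ejk)

            -- Let `m` be the neighbour that attains `D j k`: the earlier triangle inequality leads
            -- from `i` over `j` to `m`, and `w m k` enters `k`. The outgoing case is the mirror
            -- image.
            triangle-in : ∀ {i j} → i Fin.< k → j Fin.< k → D i k ≤⁺ D i j +⁺ D j k
            triangle-in {i} {j} i<k j<k with in≡ j<k
            ... | inj₁ eq            = subst (λ x → D i k ≤⁺ D i j +⁺ x) (sym eq) (≤+⁺⊤⁺ (D i j))
            ... | inj₂ (m , nb , eq) = begin
              D i k                       ≤⟨ in≤ i<k nb ⟩
              D i m +⁺ w m k              ≤⟨ +⁺-monoˡ (triangle-< i<k j<k (proj₁ nb)) ⟩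
              (D i j +⁺ D j m) +⁺ w m k   ≈⟨ +⁺-assoc (D i j) (D j m) (w m k) ⟩
              D i j +⁺ (D j m +⁺ w m k)   ≡⟨ cong (D i j +⁺_) eq ⟨
              D i j +⁺ D j k              ∎

            triangle-out : ∀ {i j} → i Fin.< k → j Fin.< k → D k i ≤⁺ D k j +⁺ D j i
            triangle-out {i} {j} i<k j<k with out≡ j<k
            ... | inj₁ eq            = subst (λ x → D k i ≤⁺ x +⁺ D j i) (sym eq) (_ ≤⊤⁺)
            ... | inj₂ (m , nb , eq) = begin
              D k i                       ≤⟨ out≤ i<k nb ⟩
              w k m +⁺ D m i              ≤⟨ +⁺-monoʳ (w k m) (triangle-< (proj₁ nb) j<k i<k) ⟩
              w k m +⁺ (D m j +⁺ D j i)   ≈⟨ +⁺-assoc (w k m) (D m j) (D j i) ⟨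
              (w k m +⁺ D m j) +⁺ D j i   ≡⟨ cong (_+⁺ D j i) eq ⟨
              D k j +⁺ D j i              ∎

            -- `D i k` enters `k` from some `m`, and `D k l` leaves it to some `m′`. By `bridge` the
            -- passage over `k` costs at least `D m m′`, which leaves a chain among earlier
            -- vertices.
            triangle-through : ∀ {i l} → i Fin.< k → l Fin.< k → D i l ≤⁺ D i k +⁺ D k l
            triangle-through {i} {l} i<k l<k with in≡ i<k | out≡ l<k
            ... | inj₁ eq | _       = subst (λ x → D i l ≤⁺ x +⁺ D k l) (sym eq) (_ ≤⊤⁺)
            ... | _       | inj₁ eq = subst (λ x → D i l ≤⁺ D i k +⁺ x) (sym eq) (≤+⁺⊤⁺ (D i k))
            ... | inj₂ (m , nb , eq) | inj₂ (m′ , nb′ , eq′) = begin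
              D i l
                ≤⟨ triangle-< i<k (proj₁ nb) l<k ⟩
              D i m +⁺ D m l
                ≤⟨ +⁺-monoʳ (D i m) (triangle-< (proj₁ nb) (proj₁ nb′) l<k) ⟩
              D i m +⁺ (D m m′ +⁺ D m′ l)
                ≤⟨ +⁺-monoʳ (D i m) (+⁺-monoˡ (bridge nb nb′)) ⟩
              D i m +⁺ ((w m k +⁺ w k m′) +⁺ D m′ l)
                ≤⟨ +⁺-monoʳ (D i m) (≤⁺-reflexive (+⁺-assoc (w m k) (w k m′) (D m′ l))) ⟩
              D i m +⁺ (w m k +⁺ (w k m′ +⁺ D m′ l))
                ≈⟨ +⁺-assoc (D i m) (w m k) _ ⟨
              (D i m +⁺ w m k) +⁺ (w k m′ +⁺ D m′ l)
                ≡⟨ cong₂ _+⁺_ eq eq′ ⟨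
              D i k +⁺ D k l ∎

          triangle′ : ∀ i j l → toℕ i < suc (toℕ k) → toℕ j < suc (toℕ k) → toℕ l < suc (toℕ k) →
                      D i l ≤⁺ D i j +⁺ D j l
          triangle′ i j l i≤k j≤k l≤k with split i≤k | split j≤k | split l≤k
          ... | inj₁ i<k  | inj₁ j<k  | inj₁ l<k  = triangle-< i<k j<k l<k
          ... | inj₁ i<k  | inj₁ j<k  | inj₂ refl = triangle-in i<k j<k
          ... | inj₂ refl | inj₁ j<k  | inj₁ l<k  = triangle-out l<k j<k
          ... | inj₁ i<k  | inj₂ refl | inj₁ l<k  = triangle-through i<k l<k
          -- The round trip from `k` over `j` is turned into one from `j` over `k`, which is bounded
          -- below by `D j j`.
          ... | inj₂ refl | inj₁ j<k  | inj₂ refl = begin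
            D k k            ≡⟨ trans (diag k) (sym (diag j)) ⟩
            D j j            ≤⟨ triangle-through j<k j<k ⟩
            D j k +⁺ D k j   ≈⟨ +⁺-comm (D j k) (D k j) ⟩
            D k j +⁺ D j k   ∎
          ... | inj₂ refl | inj₂ refl | _         = begin
            D k l              ≈⟨ +⁺-identityˡ (D k l) ⟨
            [ 0# ] +⁺ D k l    ≡⟨ cong (_+⁺ D k l) (diag k) ⟨
            D k k +⁺ D k l     ∎
          ... | _         | inj₂ refl | inj₂ refl = begin
            D i k              ≈⟨ +⁺-identityʳ (D i k) ⟨
            D i k +⁺ [ 0# ]    ≡⟨ cong (D i k +⁺_) (diag k) ⟨
            D i k +⁺ D k k     ∎

        stage : Stage (suc (toℕ k)) D
        stage = record
          { diagonal  = diag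
          ; realisedᴰ = real
          ; fresh     = fresh′
          ; ≤w        = ≤w′
          ; triangle  = triangle′
          }
          where
          fresh′ : ∀ i j → i ≢ j → k Fin.< i ⊎ k Fin.< j → D i j ≡ ⊤⁺
          fresh′ i j i≢j k< = trans
            (same i j (λ (i<k , j≡k) → off k< i<k j≡k) (λ (i≡k , j<k) → off′ k< i≡k j<k))
            (fresh st i j i≢j (Sum.map ℕₚ.<⇒≤ ℕₚ.<⇒≤ k<))
            where
            off : k Fin.< i ⊎ k Fin.< j → i Fin.< k → j ≢ k
            off (inj₁ k<i) i<k _    = <-asym k<i i<k
            off (inj₂ k<j) _   refl = <-irrefl refl k<j
            off′ : k Fin.< i ⊎ k Fin.< j → i ≡ k → ¬ (j Fin.< k)
            off′ (inj₁ k<i) refl _  = <-irrefl refl k<i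
            off′ (inj₂ k<j) _   j<k = <-asym k<j j<k

          ≤w′ : ∀ i j → toℕ i < suc (toℕ k) → toℕ j < suc (toℕ k) → i ≢ j → D i j ≤⁺ w i j
          ≤w′ i j i≤k j≤k i≢j with split i≤k | split j≤k
          ... | inj₁ i<k  | inj₁ j<k  = ≤w-< i<k j<k i≢j
          ... | inj₁ i<k  | inj₂ refl = in-w i<k
          ... | inj₂ refl | inj₁ j<k  = out-w j<k
          ... | inj₂ refl | inj₂ refl = contradiction refl i≢j

    propagate : Matrix (Carrier ⁺) n → Comp (Matrix (Carrier ⁺) n)
    propagate D = for (allFin n) D λ k D → do
      ns ← lowerNeighbours E k
      for ns D λ j D →
        for (below k) D λ i D → do
          D-ij ← read D i j
          w-jk ← read w j k
          D    ← relax i k D-ij w-jk D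
          w-kj ← read w k j
          D-ji ← read D j i
          relax k i w-kj D-ji D

    propagate-runs : ∀ {D} → Stage 0 D → Runs NegativeCycle passCost (Stage n) (propagate D)
    propagate-runs = for-ascending id stepCost Stage extend
      where
      extend : ∀ k {D} → Stage (toℕ k) D →
               Runs NegativeCycle (stepCost k) (Stage (suc (toℕ k))) _
      extend k {D₀} st =
        weaken (ℕₚ.+-monoˡ-≤ _ (ℕₚ.*-monoˡ-≤ 3 (length-below k))) id
          (lowerNeighbours-runs E k then λ { refl →
            weaken
              -- At most `n` inner iterations of 13 steps each, within the common 21.
              (scan-cost within k (ℕₚ.*-mono-≤ (length-below k) (ℕₚ.m≤m+n 13 8)))
              (λ (p , _ , thr) → Complete.stage p λ (j<k , e) i<k →
                thr (reverse⁺ (∈-lower E j<k e)) (∈-below i<k))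
              (for-all Partial (λ j D → ∀ {i} → i ∈ˡ below k → Through j i D) _⊒_
                (λ u v → ≤⁺-refl) ⊒-trans (λ ge thr i∈ → through-mono ge (thr i∈))
                (reverse (lower E k))
                (λ {j} j∈ p₁ → for-all Partial (Through j) _⊒_
                  (λ u v → ≤⁺-refl) ⊒-trans through-mono (below k)
                  (λ i∈ p₂ →
                    let open Relax p₂ (∈-below⁻ i∈) (∈-lower⁻ E (reverse⁻ j∈))
                    in ℕₚ.≤-refl , returned (partial , decrease , through))
                  p₁)
                partial₀) })
        where open Extend D₀ k st

    stage₀ : ∀ {D} → (∀ i j → i ≢ j → D i j ≡ ⊤⁺) → (∀ i → D i i ≡ [ 0# ]) → Stage 0 D
    stage₀ {D} ⊤-off diag = record
      { diagonal  = diag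
      ; realisedᴰ = real
      ; fresh     = λ i j i≢j _ → ⊤-off i j i≢j
      ; ≤w        = λ _ _ ()
      ; triangle  = λ _ _ _ _ ()
      }
      where
      real : ∀ i j → Realised i j (D i j)
      real i j with i ≟ j
      ... | yes refl = subst (Realised i i) (sym (diag i)) realised-0
      ... | no i≢j   = subst (Realised i j) (sym (⊤-off i j i≢j)) λ ()

    correct : ∀ {D} → Stage n D → Correct D
    correct {D} st ¬neg =
      no-negative-cycle (diagonal st) D≤arc triangle′ ,
      isDistance (diagonal st) D≤arc triangle′ (realisedᴰ st)
      where
      triangle′ : ∀ i j l → D i l ≤⁺ D i j +⁺ D j l
      triangle′ i j l = triangle st ¬neg i j l (toℕ<n i) (toℕ<n j) (toℕ<n l)
      D≤arc : ∀ i j → D i j ≤⁺ arc i j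
      D≤arc i j with i ≟ j
      -- `≤w` concerns distinct vertices; on the diagonal the arc is infinite, as there are no
      -- loops.
      ... | yes refl = subst (D i i ≤⁺_) (sym (no-loop i)) (_ ≤⊤⁺)
      ... | no i≢j   = ≤⁺-trans (≤w st i j (toℕ<n i) (toℕ<n j) i≢j) (≤arc i j)

    initialise-runs : Runs NegativeCycle (n * 2) (Stage 0)
      (for (allFin n) (λ _ _ → ⊤⁺) λ i → write i i [ 0# ])
    initialise-runs = weaken
      (ℕₚ.*-monoˡ-≤ 2 (ℕₚ.≤-reflexive (length-tabulate {n = n} id)))
      (λ (off , _ , diag) → stage₀ off λ i → diag (∈-allFin i))
      (for-all (λ D → ∀ i j → i ≢ j → D i j ≡ ⊤⁺) (λ i D → D i i ≡ [ 0# ])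
        -- The order between states is preservation of the zeros already written.
        (λ D D′ → ∀ i → D i i ≡ [ 0# ] → D′ i i ≡ [ 0# ])
        (λ _ → id) (λ f g i → g i ∘ f i) (λ {i} f → f i) (allFin n)
        (λ {i} {D} _ off → ℕₚ.≤-refl , returned
          ( (λ u v u≢v → trans (update-off i i [ 0# ] D λ { (refl , refl) → u≢v refl })
                               (off u v u≢v))
          , (λ u → update-elim i i [ 0# ] D (_≡ [ 0# ]) {u} {u} (λ _ _ → refl))
          , update-at i i [ 0# ] D))
        (λ _ _ _ → refl))

    fill-runs : Runs NegativeCycle (n * n + (n * 2 + passCost)) Correct
      (allocate ⊤⁺ >>= λ D →
       for (allFin n) D (λ i → write i i [ 0# ]) >>= propagate)
    fill-runs = charge (n * n)
      (weaken ℕₚ.≤-refl correct (initialise-runs then propagate-runs))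

  snowball-runs : Runs NegativeCycle (passCost + (n * n + (n * 2 + passCost))) Correct
                    (snowball (network G))
  snowball-runs = dpc-runs then λ (s , closed) → Phase.fill-runs s closed

  -- The cost in terms of vertices and edges

  edges : ℕ
  edges = edgeCount Filled

  -- Filled edges are counted at their upper ends, so the degrees in `stepCost` add up to `edges`.
  passCost≡ : passCost ≡ n * suc (n * 3) + edges * suc (n * 21)
  passCost≡ = trans (sum-map-affine (suc (n * 3)) (degree Filled) (suc (n * 21)) (allFin n))
    (cong (λ l → l * suc (n * 3) + edges * suc (n * 21)) (length-tabulate {n = n} id))
    where
    open +-*-Solver
    sum-map-affine : ∀ a (f : Fin n → ℕ) b xs →
                     sum (map (λ x → a + f x * b) xs) ≡ length xs * a + sum (map f xs) * b
    sum-map-affine a f b []       = refl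
    sum-map-affine a f b (x ∷ xs) = trans
      (cong (a + f x * b +_) (sum-map-affine a f b xs))
      (solve 5 (λ a y b l z → (a :+ y :* b) :+ (l :* a :+ z :* b) :=
                              (a :+ l :* a) :+ (y :+ z) :* b)
        refl a (f x) b (length xs) (sum (map f xs)))

-- Correctness and running time

accepted : ∀ {a f q} {A : Set a} {F : Set f} {Q : A → Set q} {o} →
           ¬ F → Outcome F Q o → ∃ λ x → o ≡ just x × Q x
accepted ¬f (stopped f)  = contradiction f ¬f
accepted ¬f (returned q) = _ , refl , q

rejected : ∀ {a f q} {A : Set a} {F : Set f} {Q : A → Set q} {o} →
           (∀ {x} → ¬ Q x) → Outcome F Q o → o ≡ INCONSISTENT
rejected ¬q (stopped _)  = refl
rejected ¬q (returned q) = contradiction q ¬q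

-- Expanding leaves the linear terms `4 * n + 2 * m`, which the hypotheses absorb into the quadratic
-- ones.
polynomial-≤ : ∀ n m → n ≤ n * n → m ≤ n * m →
  let c = n * suc (n * 3) + m * suc (n * 21) in
  c + (n * n + (n * 2 + c)) ≤ 44 * (n * n + n * m)
polynomial-≤ n m n≤n² m≤nm = begin
  c + (n * n + (n * 2 + c))
    ≡⟨ solve 2 (λ n m →
         let c = n :* (con 1 :+ n :* con 3) :+ m :* (con 1 :+ n :* con 21) in
         c :+ (n :* n :+ (n :* con 2 :+ c)) :=
         (con 7 :* (n :* n) :+ con 42 :* (n :* m)) :+ (con 4 :* n :+ con 2 :* m)) refl n m ⟩
  (7 * (n * n) + 42 * (n * m)) + (4 * n + 2 * m)
    ≤⟨ ℕₚ.+-monoʳ-≤ (7 * (n * n) + 42 * (n * m))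
         (ℕₚ.+-mono-≤ (ℕₚ.*-monoʳ-≤ 4 n≤n²) (ℕₚ.*-monoʳ-≤ 2 m≤nm)) ⟩
  (7 * (n * n) + 42 * (n * m)) + (4 * (n * n) + 2 * (n * m))
    -- The coefficient of `n * n` is padded from 11 to 44, that of `n * m`.
    ≤⟨ ℕₚ.m≤m+n _ (33 * (n * n)) ⟩
  (7 * (n * n) + 42 * (n * m)) + (4 * (n * n) + 2 * (n * m)) + 33 * (n * n)
    ≡⟨ solve 2 (λ x y → (con 7 :* x :+ con 42 :* y) :+ (con 4 :* x :+ con 2 :* y) :+ con 33 :* x :=
                        con 44 :* (x :+ y)) refl (n * n) (n * m) ⟩
  44 * (n * n + n * m) ∎
  where
  open ℕₚ.≤-Reasoning
  open +-*-Solver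
  c = n * suc (n * 3) + m * suc (n * 21)

n≤n*n : ∀ n → n ≤ n * n
n≤n*n zero    = z≤n
n≤n*n (suc n) = ℕₚ.m≤m*n (suc n) (suc n)

edgeCount≤n*edgeCount : ∀ n (E : Matrix Bool n) → edgeCount E ≤ n * edgeCount E
edgeCount≤n*edgeCount zero    E = z≤n
edgeCount≤n*edgeCount (suc n) E = ℕₚ.m≤m+n _ _

-- Invariance under relabelling

module Relabel {c ℓ₁ ℓ₂} (W : DecTotallyOrderedAbelianGroup c ℓ₁ ℓ₂)
               {V : Set} {n : ℕ} (d : V ↔ Fin n) (G : Weighted.Graph W V) where

  open DecTotallyOrderedAbelianGroup W using (_<ʷ_; _≤ʷ_; _≈_; 0#) renaming (_+_ to _+ʷ_)
  open Weighted W
  open Inverse d using (to; from; strictlyInverseʳ)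

  private
    P : Graph (Fin n)
    P = relabel d G
    module G = Graph G
    module P = Graph P

  -- Arcs of `P` are by definition arcs of `G` between preimages, so `path⁻` copies them; `path⁺`
  -- has to cancel the round trip `from (to u)`.
  arc-to : ∀ u v → P.arc (to u) (to v) ≡ G.arc u v
  arc-to u v = cong₂ G.arc (strictlyInverseʳ u) (strictlyInverseʳ v)

  path⁺ : ∀ {u v} (p : G.Path u v) → Σ (P.Path (to u) (to v)) λ q → P.weight q ≡ G.weight p
  path⁺ ε = ε , refl
  path⁺ (_◅_ {i = u} {j = v} (x , eq) p) =
    let (q , weight≡) = path⁺ p in (x , trans (arc-to u v) eq) ◅ q , cong (x +ʷ_) weight≡

  path⁻ : ∀ {i j} (p : P.Path i j) → Σ (G.Path (from i) (from j)) λ q → G.weight q ≡ P.weight p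
  path⁻ ε             = ε , refl
  path⁻ ((x , eq) ◅ p) = let (q , weight≡) = path⁻ p in (x , eq) ◅ q , cong (x +ʷ_) weight≡

  negativeCycle⁺ : G.NegativeCycle → P.NegativeCycle
  negativeCycle⁺ (v , p , neg) =
    let (q , weight≡) = path⁺ p in to v , q , subst (_<ʷ 0#) (sym weight≡) neg

  negativeCycle⁻ : P.NegativeCycle → G.NegativeCycle
  negativeCycle⁻ (i , p , neg) =
    let (q , weight≡) = path⁻ p in from i , q , subst (_<ʷ 0#) (sym weight≡) neg

  negativeTwoCycle⁻ : P.NegativeTwoCycle → G.NegativeTwoCycle
  negativeTwoCycle⁻ (i , j , cycle) = from i , from j , cycle

  isDistance⁻ : ∀ {u v x} → P.IsDistance (to u) (to v) x → G.IsDistance u v x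
  isDistance⁻ (Graph.unreachable ¬path) = Graph.unreachable (¬path ∘ proj₁ ∘ path⁺)
  isDistance⁻ {u} {v} {[ x ]} (Graph.shortest p p≈ p≤)
    with (q , weight≡) ← path⁻ p
    -- `path⁻` joins `from (to u)` to `from (to v)`, which are to become `u` and `v`.
    rewrite strictlyInverseʳ u | strictlyInverseʳ v =
    Graph.shortest q (subst (_≈ x) (sym weight≡) p≈) λ r →
      let (r′ , weight′≡) = path⁺ r in subst (x ≤ʷ_) weight′≡ (p≤ r′)

-- Guarantees for a single input

module Analysis {c ℓ₁ ℓ₂} (W : DecTotallyOrderedAbelianGroup c ℓ₁ ℓ₂)
                (x : Weighted.Input W) where

  open Weights W
  open Input x

  private
    module P = Snowball W positioned
    module R = Relabel W d G
    module G = Distances G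

  run-runs : Runs P.NegativeCycle (P.passCost + (n * n + (n * 2 + P.passCost))) P.Correct run
  run-runs = P.snowball-runs

  -- A stop would exhibit a negative cycle. A negative 2-cycle is one too, so the hypothesis of
  -- `Correct` is met.
  computes-distances : ¬ G.NegativeCycle →
    ∃ λ D → output ≡ just D × (∀ u v → G.IsDistance u v (D (position u) (position v)))
  computes-distances ¬neg =
    let (D , eq , correct) = accepted (¬neg ∘ R.negativeCycle⁻) (Runs.outcome run-runs)
        (_ , distances)    = correct (¬neg ∘ G.two-cycle⇒cycle ∘ R.negativeTwoCycle⁻)
    in D , eq , λ u v → R.isDistance⁻ (distances (position u) (position v))

  -- Had a matrix been returned, `Correct` would exclude the given cycle.
  detects-inconsistency : ¬ G.NegativeTwoCycle → G.NegativeCycle → output ≡ INCONSISTENT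
  detects-inconsistency ¬neg² neg = rejected
    (λ correct → proj₁ (correct (¬neg² ∘ R.negativeTwoCycle⁻)) (R.negativeCycle⁺ neg))
    (Runs.outcome run-runs)

  time-≤ : time ≤ 44 * (n * n + n * m-c)
  time-≤ = ℕₚ.≤-trans (Runs.cost run-runs)
    (subst (λ t → t + (n * n + (n * 2 + t)) ≤ 44 * (n * n + n * m-c)) (sym P.passCost≡)
      (polynomial-≤ n m-c (n≤n*n n) (edgeCount≤n*edgeCount n P.Filled)))

  -- A neighbour differs from its vertex, as there are no loops, and triangulation keeps the edges
  -- of the input.
  n≤2*m-c : G.HasNoIsolatedVertex → n ≤ m-c + m-c
  n≤2*m-c covered = n≤2*edgeCount P.Filled neighbour
    where
    open Inverse d using (to; from; strictlyInverseʳ)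

    irreflexive : ∀ i → ¬ T (P.edge i i)
    irreflexive i e rewrite P.no-loop i = e

    neighbour : ∀ j → ∃ λ i → i ≢ j × T (P.Filled i j) × T (P.Filled j i)
    neighbour j with covered (from j)
    ... | u , e =
      to u , (λ { refl → irreflexive (to u) e⁻ }) ,
      triangulate-⊇ P.edge e⁻ , triangulate-⊇ P.edge e⁺
      where
      e⁻ : T (P.edge (to u) j)
      e⁻ = subst (λ u′ → T (G.edge u′ (from j))) (sym (strictlyInverseʳ u)) e

      e⁺ : T (P.edge j (to u))
      e⁺ = P.edge-sym {to u} {j} e⁻

  time-≤-covered : G.HasNoIsolatedVertex → time ≤ 132 * (n * m-c)
  time-≤-covered covered = begin
    time
      ≤⟨ time-≤ ⟩
    44 * (n * n + n * m-c)
      -- One factor of `n * n` becomes `m-c + m-c`, so that 132 is three times 44.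
      ≤⟨ ℕₚ.*-monoʳ-≤ 44 (ℕₚ.+-monoˡ-≤ (n * m-c) (ℕₚ.*-monoʳ-≤ n (n≤2*m-c covered))) ⟩
    44 * (n * (m-c + m-c) + n * m-c)
      ≡⟨ solve 2 (λ n m → con 44 :* (n :* (m :+ m) :+ n :* m) := con 132 :* (n :* m))
           refl n m-c ⟩
    132 * (n * m-c) ∎
    where
    open ℕₚ.≤-Reasoning
    open +-*-Solver

  n*m-c≤n*n*w-d : n * m-c ≤ n * n * w-d
  n*m-c≤n*n*w-d = ℕₚ.≤-trans
    (ℕₚ.*-monoʳ-≤ n (edgeCount≤n*inducedWidth P.edge (λ {i} {j} → P.edge-sym {i} {j})))
    (ℕₚ.≤-reflexive (sym (ℕₚ.*-assoc n n w-d)))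

theorem3 : ∀ {c ℓ₁ ℓ₂ : Level} (W : DecTotallyOrderedAbelianGroup c ℓ₁ ℓ₂) →
  let open Weighted W
      open Graph
      open Input
  in
  -- DPC only compares w(i→j) + w(j→i) with 0 on pairs that it has just
  -- relaxed, so a negative 2-cycle on any other pair can go unnoticed.
    (∀ (x : Input) →
      (¬ NegativeCycle (G x) →
        ∃ λ D → output x ≡ just D ×
          (∀ u v → IsDistance (G x) u v (D (position x u) (position x v)))) ×
      (¬ NegativeTwoCycle (G x) → NegativeCycle (G x) →
        output x ≡ INCONSISTENT)) ×
  -- Filling D takes n² steps whatever m-c is (it is 0 without edges).
    time ∈ O[ (λ x → HasNoIsolatedVertex (G x)) ] (λ x → n x * m-c x) ×
    time ∈ O[ U ] (λ x → n x * n x + n x * m-c x) ×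
    (∀ (P : Pred Input 0ℓ) →
      O[ P ] (λ x → n x * m-c x) ⊆ O[ P ] (λ x → n x * n x * w-d x))
theorem3 W =
  (λ x → computes-distances W x , detects-inconsistency W x) ,
  (132 , λ x → time-≤-covered W x) ,
  (44 , λ x _ → time-≤ W x) ,
  (λ P (C , g≤) → C , λ x px →
    ℕₚ.≤-trans (g≤ x px) (ℕₚ.*-monoʳ-≤ C (n*m-c≤n*n*w-d W x)))
  where open Analysis
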